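{- There are infinitely many (pairwise non-isomorphic) critical $2$-degenerate graphs $H$ such that $\mathrm{ex}(n,H) = O(n^{3/2})$.
   Context: A graph is $r$-degenerate if each of its subgraphs has minimum degree at most $r$. A graph $G$ is critical $r$-degenerate if $G$ is $r$-degenerate, exactly one vertex of $G$ has degree $r$, and every other vertex has degree at least $r+1$. $\mathrm{ex}(n,H)$ is the maximum number of edges in an $n$-vertex graph containing no subgraph isomorphic to $H$; $O$ refers to $n\to\infty$ with constants depending on $H$. -}

module Defs where

open import Data.Nat using (ℕ; zero; suc; _+_; _*_; _≤_; _≥_)
open import Data.Nat.Base using (_<ᵇ_)
open import Data.Bool using (Bool; true; false; if_then_else_; _∧_)
open import Data.Fin using (Fin; zero; suc; toℕ)
open import Data.Product using (Σ; ∃; _×_)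
open import Relation.Binary.PropositionalEquality using (_≡_; _≢_)
open import Relation.Nullary using (¬_)
open import Function using (_∘_)

record Graph : Set where
  field
    size   : ℕ
    adj    : Fin size → Fin size → Bool
    sym    : ∀ u v → adj u v ≡ adj v u
    irrefl : ∀ v → adj v v ≡ false
open Graph public

count : {n : ℕ} → (Fin n → Bool) → ℕ
count {zero}  p = 0
count {suc n} p = (if p zero then 1 else 0) + count (p ∘ suc)

sumFin : {n : ℕ} → (Fin n → ℕ) → ℕ
sumFin {zero}  f = 0
sumFin {suc n} f = f zero + sumFin (f ∘ suc)

degree : (G : Graph) → Fin (size G) → ℕ
degree G v = count (adj G v)

edges : Graph → ℕ
edges G = sumFin (λ i → count (λ j → adj G i j ∧ (toℕ i <ᵇ toℕ j)))

record Subgraph (G : Graph) : Set where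
  field
    verts    : Fin (size G) → Bool
    edgesOf  : Fin (size G) → Fin (size G) → Bool
    esym     : ∀ u v → edgesOf u v ≡ edgesOf v u
    esub     : ∀ u v → edgesOf u v ≡ true → adj G u v ≡ true
    eleft    : ∀ u v → edgesOf u v ≡ true → verts u ≡ true
    eright   : ∀ u v → edgesOf u v ≡ true → verts v ≡ true
open Subgraph public

subDegree : {G : Graph} → Subgraph G → Fin (size G) → ℕ
subDegree H v = count (edgesOf H v)

Degenerate : ℕ → Graph → Set
Degenerate r G = (H : Subgraph G) → (∃ λ v → verts H v ≡ true) →
                 ∃ λ v → verts H v ≡ true × subDegree H v ≤ r

CriticalDegenerate : ℕ → Graph → Set
CriticalDegenerate r G =
  Degenerate r G ×
  (∃ λ v → degree G v ≡ r × (∀ u → u ≢ v → degree G u ≥ suc r))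

Contains : Graph → Graph → Set
Contains G H = Σ (Fin (size H) → Fin (size G)) λ f →
  (∀ u v → f u ≡ f v → u ≡ v) ×
  (∀ u v → adj H u v ≡ true → adj G (f u) (f v) ≡ true)

Isomorphic : Graph → Graph → Set
Isomorphic G H = Σ (Fin (size G) → Fin (size H)) λ f →
  Σ (Fin (size H) → Fin (size G)) λ g →
  (∀ v → g (f v) ≡ v) × (∀ w → f (g w) ≡ w) ×
  (∀ u v → adj H (f u) (f v) ≡ adj G u v)

-- ex(n,H) = O(n^{3/2}) : there are constants C, N such that for all n ≥ N,
-- every H-free n-vertex graph G has e(G) ≤ C n^{3/2}, i.e. e(G)^2 ≤ C^2 n^3.
ExO3/2 : Graph → Set
ExO3/2 H = ∃ λ (C : ℕ) → ∃ λ (N : ℕ) → ∀ (G : Graph) → size G ≥ N →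
  ¬ Contains G H →
  edges G * edges G ≤ (C * C) * (size G * size G * size G)

{-# OPTIONS --safe #-}
module Submission where

{- Fix a vertex r and m of its neighbours, all of degree at least d m with d large and m² ≈ |G|.
Every other vertex y traces on them a set I y of neighbours, and these traces have total size
about d m².  If some large set of points has all its triples in many traces, H embeds greedily.
Otherwise each trace splits, up to a bounded remainder, into disjoint triples which lie in few
traces, so there are at least C m² distinct labelled triples on m points.  Füredi's argument for
generalised 4-cycles then gives disjoint pairs {a,b}, {a′,b′} and points c, c′ such that all of
abc, abc′, a′b′c, a′b′c′ are triples.  These six points, their four labels and r carry the graph
H 0, in which every vertex has degree at least 3 except c′ (not joined to r).  Discarding first
the triples having a pair in few triples, one may append alternately labels and points to c′,
which yields arbitrarily large critical graphs. -}

open import Defs hiding (sym)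
open import Data.Nat
open import Data.Nat.Properties
open import Data.Nat.Tactic.RingSolver using (solve-∀)
open import Data.Bool using (Bool; true; false; if_then_else_; _∧_; _∨_; not; T)
open import Data.Bool.Properties using (∨-comm; ∧-zeroʳ; T-≡)
open import Data.Fin using (Fin; zero; suc; toℕ; fromℕ<)
import Data.Fin.Properties as Fin
import Data.Bool as Bool
open import Data.List using (List; []; _∷_; length; _++_; applyUpTo; upTo; tabulate)
open import Data.List.Relation.Unary.All as All using (All; []; _∷_)
open import Data.List.Relation.Unary.AllPairs using (AllPairs; []; _∷_)
open import Data.List.Relation.Unary.Any as Any using (here; there)
open import Data.List.Properties using (length-++; length-applyUpTo; length-tabulate)
open import Data.List.Membership.Propositional using (_∈_; _∉_)
open import Data.List.Membership.Propositional.Properties using (∈-++⁺ˡ; ∈-++⁺ʳ; ∈-applyUpTo⁺; ∈-upTo⁺; ∈-tabulate⁺)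
open import Data.List.Relation.Unary.All.Properties using (applyUpTo⁻)
open import Data.Product using (Σ; ∃; _×_; _,_; proj₁; proj₂)
open import Data.Sum using (_⊎_; inj₁; inj₂; [_,_]′)
open import Data.Empty using (⊥; ⊥-elim)
open import Data.Unit using (⊤; tt)
open import Relation.Binary.PropositionalEquality using (_≡_; _≢_; refl; sym; trans; cong; cong₂; subst)
open import Relation.Nullary using (¬_; Dec; yes; no; does; contradiction)
open import Relation.Nullary.Decidable using (True; toWitness; _×-dec_; ¬?; dec-true; dec-false)
open import Function using (_∘_)
open import Function.Bundles using (Equivalence)

private variable
  n m : ℕ

-- Boolean connectives and indicators.

ind : Bool → ℕ
ind b = if b then 1 else 0

ind≤1 : ∀ b → ind b ≤ 1
ind≤1 false = z≤n
ind≤1 true  = s≤s z≤n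

ind-mono : ∀ {b c} → (b ≡ true → c ≡ true) → ind b ≤ ind c
ind-mono {false} h = z≤n
ind-mono {true}  h rewrite h refl = ≤-refl

∧-left : ∀ {b c} → b ∧ c ≡ true → b ≡ true
∧-left {true} _ = refl

∧-right : ∀ {b c} → b ∧ c ≡ true → c ≡ true
∧-right {true} h = h

∧-intro : ∀ {b c} → b ≡ true → c ≡ true → b ∧ c ≡ true
∧-intro refl refl = refl

∨-elim : ∀ {b c} → b ∨ c ≡ true → b ≡ true ⊎ c ≡ true
∨-elim {true}  h = inj₁ refl
∨-elim {false} h = inj₂ h

∨-introˡ : ∀ {b c} → b ≡ true → b ∨ c ≡ true
∨-introˡ refl = refl

∨-introʳ : ∀ {b c} → c ≡ true → b ∨ c ≡ true
∨-introʳ {false} h = h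
∨-introʳ {true}  h = refl

not-true : ∀ {b} → not b ≡ true → b ≡ false
not-true {false} _ = refl

does-true : ∀ {a} {A : Set a} (d : Dec A) → does d ≡ true → A
does-true (yes x) _ = x

true-or-false : ∀ b → b ≡ true ⊎ b ≡ false
true-or-false true  = inj₁ refl
true-or-false false = inj₂ refl

true≢false : ∀ {b} → b ≡ true → b ≡ false → ⊥
true≢false refl ()

-- Sums and counting

sum-mono : {f g : Fin n → ℕ} → (∀ i → f i ≤ g i) → sumFin f ≤ sumFin g
sum-mono {zero}  h = z≤n
sum-mono {suc n} h = +-mono-≤ (h zero) (sum-mono (h ∘ suc))

sum-strict : {f g : Fin n → ℕ} → (∀ i → f i ≤ g i) → ∀ i → suc (f i) ≤ g i →
             suc (sumFin f) ≤ sumFin g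
sum-strict h zero    s = +-mono-≤ s (sum-mono (h ∘ suc))
sum-strict {f = f} h (suc i) s =
  ≤-trans (≤-reflexive (sym (+-suc (f zero) _))) (+-mono-≤ (h zero) (sum-strict (h ∘ suc) i s))

sum-+ : (f g : Fin n → ℕ) → sumFin (λ i → f i + g i) ≡ sumFin f + sumFin g
sum-+ {zero}  f g = refl
sum-+ {suc n} f g rewrite sum-+ (f ∘ suc) (g ∘ suc) =
  trans (+-assoc (f zero) _ _)
   (trans (cong (f zero +_) (trans (sym (+-assoc (g zero) F G))
            (trans (cong (_+ G) (+-comm (g zero) F)) (+-assoc F (g zero) G))))
          (sym (+-assoc (f zero) F _)))
  where F = sumFin (f ∘ suc)
        G = sumFin (g ∘ suc)

sum-* : (k : ℕ) (f : Fin n → ℕ) → sumFin (λ i → k * f i) ≡ k * sumFin f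
sum-* {zero}  k f = sym (*-zeroʳ k)
sum-* {suc n} k f rewrite sum-* k (f ∘ suc) = sym (*-distribˡ-+ k (f zero) _)

sum-const : (k : ℕ) → sumFin {n} (λ _ → k) ≡ n * k
sum-const {zero}  k = refl
sum-const {suc n} k = cong (k +_) (sum-const {n} k)

sum-≤ : {f : Fin n → ℕ} {k : ℕ} → (∀ i → f i ≤ k) → sumFin f ≤ n * k
sum-≤ {n} {k = k} h = ≤-trans (sum-mono h) (≤-reflexive (sum-const {n} k))

sum-swap : (f : Fin n → Fin m → ℕ) →
           sumFin (λ i → sumFin (λ j → f i j)) ≡ sumFin (λ j → sumFin (λ i → f i j))
sum-swap {zero}  {m} f = sym (trans (sum-const {m} 0) (*-zeroʳ m))
sum-swap {suc n} f rewrite sum-swap (f ∘ suc) = sym (sum-+ (f zero) _)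

sum-cong : {f g : Fin n → ℕ} → (∀ i → f i ≡ g i) → sumFin f ≡ sumFin g
sum-cong {zero}  h = refl
sum-cong {suc n} h = cong₂ _+_ (h zero) (sum-cong (h ∘ suc))

count≡sum : (p : Fin n → Bool) → count p ≡ sumFin (ind ∘ p)
count≡sum {zero}  p = refl
count≡sum {suc n} p = cong (ind (p zero) +_) (count≡sum (p ∘ suc))

count-mono : {p q : Fin n → Bool} → (∀ i → p i ≡ true → q i ≡ true) → count p ≤ count q
count-mono {zero}  h = z≤n
count-mono {suc n} h = +-mono-≤ (ind-mono (h zero)) (count-mono (h ∘ suc))

count-∪ : {p q r : Fin n → Bool} → (∀ i → p i ≡ true → q i ≡ true ⊎ r i ≡ true) →
          count p ≤ count q + count r
count-∪ {p = p} {q} {r} h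
  rewrite count≡sum p | count≡sum q | count≡sum r | sym (sum-+ (ind ∘ q) (ind ∘ r)) =
  sum-mono (λ i → step (p i) (q i) (r i) (h i))
  where
  step : ∀ a b c → (a ≡ true → b ≡ true ⊎ c ≡ true) → ind a ≤ ind b + ind c
  step false b c h = z≤n
  step true  b c h with h refl
  ... | inj₁ refl = s≤s z≤n
  ... | inj₂ refl = ≤-trans (ind≤1 true) (m≤n+m 1 (ind b))

count-none : {p : Fin n → Bool} → (∀ i → p i ≡ true → ⊥) → count p ≡ 0
count-none {zero}      h = refl
count-none {suc n} {p} h with true-or-false (p zero)
... | inj₁ e = ⊥-elim (h zero e)
... | inj₂ e rewrite e = count-none (h ∘ suc)

count-single : {p : Fin n → Bool} (x : Fin n) → (∀ i → p i ≡ true → i ≡ x) → count p ≤ 1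
count-single {suc n} {p} zero h rewrite count-none {p = p ∘ suc} (λ i e → Fin.0≢1+n (sym (h (suc i) e))) =
  ≤-trans (≤-reflexive (+-identityʳ _)) (ind≤1 (p zero))
count-single {suc n} {p} (suc x) h with true-or-false (p zero)
... | inj₁ e = ⊥-elim (Fin.0≢1+n (h zero e))
... | inj₂ e rewrite e = count-single x (λ i e → Fin.suc-injective (h (suc i) e))

count-≟ : (x : Fin n) → count (λ i → does (i Fin.≟ x)) ≤ 1
count-≟ x = count-single x (λ i → does-true (i Fin.≟ x))

count-∈ : {p : Fin n → Bool} (l : List (Fin n)) → (∀ i → p i ≡ true → i ∈ l) → count p ≤ length l
count-∈ [] h = ≤-reflexive (count-none (λ i e → contradiction (h i e) λ ()))
count-∈ {p = p} (x ∷ l) h =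
  ≤-trans (count-∪ split) (+-mono-≤ (count-≟ x) (count-∈ l rest))
  where
  p′ : _ → Bool
  p′ i = p i ∧ not (does (i Fin.≟ x))
  split : ∀ i → p i ≡ true → does (i Fin.≟ x) ≡ true ⊎ p′ i ≡ true
  split i e with does (i Fin.≟ x)
  ... | true  = inj₁ refl
  ... | false = inj₂ (∧-intro e refl)
  rest : ∀ i → p′ i ≡ true → i ∈ l
  rest i e with h i (∧-left e)
  ... | there k   = k
  ... | here refl = ⊥-elim (true≢false (dec-true (i Fin.≟ i) refl) (not-true (∧-right {p i} e)))

count-witness : {p : Fin n → Bool} → 0 < count p → ∃ λ i → p i ≡ true
count-witness {suc n} {p} h with true-or-false (p zero)
... | inj₁ e = zero , e
... | inj₂ e rewrite e = let i , q = count-witness {p = p ∘ suc} h in suc i , q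

-- Greedy choice: every member of `l` spoils at most `k` candidates. The constant `k` is 1 when
-- points must avoid used vertices, and 2 when their labels must avoid them as well.
count-avoid : {A : Set} {p : Fin n → Bool} (bad : A → Fin n → Bool) (k : ℕ) →
              (∀ u → count (bad u) ≤ k) → (l : List A) → k * length l < count p →
              ∃ λ i → p i ≡ true × (∀ {u} → u ∈ l → bad u i ≡ false)
count-avoid bad k hb [] h =
  let i , e = count-witness (≤-trans (s≤s z≤n) h) in i , e , λ ()
count-avoid {p = p} bad k hb (u ∷ l) h =
  let i , e , a = count-avoid {p = p′} bad k hb l lt in
  i , ∧-left e , λ { (here refl) → not-true (∧-right {p i} e) ; (there w) → a w }
  where
  p′ : _ → Bool
  p′ i = p i ∧ not (bad u i)
  split : ∀ i → p i ≡ true → bad u i ≡ true ⊎ p′ i ≡ true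
  split i e with bad u i
  ... | true  = inj₁ refl
  ... | false = inj₂ (∧-intro e refl)
  lt : k * length l < count p′
  lt = +-cancelˡ-< k _ _ (<-≤-trans (≤-trans (s≤s (≤-reflexive (sym (*-suc k (length l))))) h)
         (≤-trans (count-∪ split) (+-monoˡ-≤ _ (hb u))))

count-fresh : {p : Fin n → Bool} (l : List (Fin n)) → length l < count p →
              ∃ λ i → p i ≡ true × i ∉ l
count-fresh l h =
  let i , e , a = count-avoid (λ u i → does (i Fin.≟ u)) 1 count-≟ l
                    (≤-trans (s≤s (≤-reflexive (*-identityˡ _))) h)
  in i , e , λ k → true≢false (dec-true (i Fin.≟ i) refl) (a k)

-- This turns a large neighbourhood into a family indexed by `Fin m`, so that the hypergraph below
-- can live on `Fin m`.
count-inject : {p : Fin n → Bool} → m ≤ count p →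
               Σ (Fin m → Fin n) λ f → (∀ i j → f i ≡ f j → i ≡ j) × (∀ i → p (f i) ≡ true)
count-inject {m = zero} h = (λ ()) , (λ ()) , λ ()
count-inject {suc n} {suc m} {p} h with true-or-false (p zero)
... | inj₂ e rewrite e = let f , fi , fp = count-inject {p = p ∘ suc} h in
  suc ∘ f , (λ i j q → fi i j (Fin.suc-injective q)) , fp
... | inj₁ e rewrite e = let f , fi , fp = count-inject {p = p ∘ suc} (≤-pred h) in
  (λ { zero → zero ; (suc i) → suc (f i) }) ,
  (λ { zero zero q → refl ; (suc i) (suc j) q → cong suc (fi i j (Fin.suc-injective q)) }) ,
  (λ { zero → e ; (suc i) → fp i })

-- The critical 2-degenerate graphs

-- Vertex v is joined to its parents, which precede it.  Vertices 0, …, 10 are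
-- r, a, b, y, z, c, a′, y′, b′, z′, c′, and from 11 on labels (joined to the preceding vertex and
-- to b) alternate with points (joined to the preceding vertex and to r).
turn : ℕ → ℕ
turn 0             = 2
turn 1             = 0
turn (suc (suc k)) = turn k

parent₁ parent₂ : ℕ → ℕ
parent₁ 3  = 1
parent₁ 4  = 1
parent₁ 7  = 5
parent₁ 9  = 6
parent₁ 10 = 4
parent₁ (suc (suc (suc (suc (suc (suc (suc (suc (suc (suc (suc k))))))))))) = 10 + k
parent₁ _  = 0

parent₂ 3  = 2
parent₂ 4  = 2
parent₂ 5  = 3
parent₂ 7  = 6
parent₂ 8  = 7
parent₂ 9  = 8
parent₂ 10 = 9
parent₂ (suc (suc (suc (suc (suc (suc (suc (suc (suc (suc (suc k))))))))))) = turn k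
parent₂ _  = 0

-- The first conjunct discards the loop that the default parent 0 would put at vertex 0. Vertices 1,
-- 2 and 6 have both parents equal to 0, hence a single earlier neighbour.
below : ℕ → ℕ → Bool
below u v = (u <ᵇ v) ∧ ((u ≡ᵇ parent₁ v) ∨ (u ≡ᵇ parent₂ v))

linked : ℕ → ℕ → Bool
linked u v = below u v ∨ below v u

below⇒< : ∀ u v → below u v ≡ true → u < v
below⇒< u v h = <ᵇ⇒< u v (subst T (sym (∧-left h)) _)

below⇒parent : ∀ u v → below u v ≡ true → u ≡ parent₁ v ⊎ u ≡ parent₂ v
below⇒parent u v h with ∨-elim {u ≡ᵇ parent₁ v} (∧-right {u <ᵇ v} h)
... | inj₁ e = inj₁ (≡ᵇ⇒≡ u _ (subst T (sym e) _))
... | inj₂ e = inj₂ (≡ᵇ⇒≡ u _ (subst T (sym e) _))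

linked-irrefl : ∀ v → linked v v ≡ false
linked-irrefl v with true-or-false (below v v)
... | inj₁ e = ⊥-elim (<-irrefl refl (below⇒< v v e))
... | inj₂ e = cong₂ _∨_ e e

H : ℕ → Graph
H k = record
  { size   = 11 + k
  ; adj    = λ u v → linked (toℕ u) (toℕ v)
  ; sym    = λ u v → ∨-comm (below (toℕ u) (toℕ v)) _
  ; irrefl = λ v → linked-irrefl (toℕ v)
  }

is : ℕ → Fin n → Bool
is a u = does (toℕ u ≟ a)

count-is : ∀ n a → count {n} (is a) ≤ 1
count-is n a with Fin.any? {n = n} (λ u → toℕ u ≟ a)
... | yes (u , e) = count-single u (λ i q → Fin.toℕ-injective (trans (does-true (toℕ i ≟ a) q) (sym e)))
... | no ¬x = ≤-trans (≤-reflexive (count-none (λ i q → ¬x (i , does-true (toℕ i ≟ a) q)))) z≤n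

is-parent : (u : Fin n) (v : ℕ) → below (toℕ u) v ≡ true →
            is (parent₁ v) u ≡ true ⊎ is (parent₂ v) u ≡ true
is-parent u v q with below⇒parent (toℕ u) v q
... | inj₁ h = inj₁ (dec-true (toℕ u ≟ _) h)
... | inj₂ h = inj₂ (dec-true (toℕ u ≟ _) h)

-- In any subgraph the vertex of greatest index has only earlier neighbours, and these are among its
-- two parents.
H-degenerate : ∀ k → Degenerate 2 (H k)
H-degenerate k S (w , hw) = v , hv , low
  where
  top : ∀ {n} (p : Fin n → Bool) → (∃ λ i → p i ≡ true) →
        ∃ λ v → p v ≡ true × (∀ i → p i ≡ true → toℕ i ≤ toℕ v)
  top {suc n} p (i , e) with Fin.any? (λ j → p (suc j) Bool.≟ true)
  ... | yes x = let v , e , h = top (p ∘ suc) x in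
                suc v , e , λ { zero _ → z≤n ; (suc j) q → s≤s (h j q) }
  top {suc n} p (zero , e)  | no ¬x = zero , e , λ { zero _ → z≤n ; (suc j) q → ⊥-elim (¬x (j , q)) }
  top {suc n} p (suc i , e) | no ¬x = ⊥-elim (¬x (i , e))
  v   = proj₁ (top (verts S) (w , hw))
  hv  = proj₁ (proj₂ (top (verts S) (w , hw)))
  max = proj₂ (proj₂ (top (verts S) (w , hw)))
  nbr : ∀ u → edgesOf S v u ≡ true →
        is (parent₁ (toℕ v)) u ≡ true ⊎ is (parent₂ (toℕ v)) u ≡ true
  nbr u e with ∨-elim {below (toℕ v) (toℕ u)} (esub S v u e)
  ... | inj₁ q = ⊥-elim (≤⇒≯ (max u (eright S v u e)) (below⇒< (toℕ v) _ q))
  ... | inj₂ q = is-parent u (toℕ v) q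
  low : subDegree S v ≤ 2
  low = ≤-trans (count-∪ nbr) (+-mono-≤ (count-is (11 + k) (parent₁ (toℕ v))) (count-is (11 + k) (parent₂ (toℕ v))))

count-erase : {p : Fin n → Bool} (x : Fin n) → p x ≡ true →
              suc (count (λ i → p i ∧ not (does (i Fin.≟ x)))) ≤ count p
count-erase {p = p} x e
  rewrite count≡sum p | count≡sum (λ i → p i ∧ not (does (i Fin.≟ x))) =
  sum-strict (λ i → ind-mono (∧-left {p i})) x
    (subst (λ b → suc (ind (p x ∧ not b)) ≤ ind (p x)) (sym (dec-true (x Fin.≟ x) refl))
      (subst (λ b → suc (ind (b ∧ false)) ≤ ind b) (sym e) ≤-refl))

count-≥ : {p : Fin n → Bool} {l : List (Fin n)} → AllPairs _≢_ l →
          All (λ i → p i ≡ true) l → length l ≤ count p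
count-≥ {l = []}    []       []       = z≤n
count-≥ {l = x ∷ l} (d ∷ ds) (e ∷ es) =
  ≤-trans (s≤s (count-≥ ds (All.zipWith keep (d , es)))) (count-erase x e)
  where
  keep : ∀ {i} → x ≢ i × _ → _
  keep {i} (ne , q) = ∧-intro q (cong not (dec-false (i Fin.≟ x) (ne ∘ sym)))

turn≤2 : ∀ j → turn j ≤ 2
turn≤2 0             = ≤-refl
turn≤2 1             = z≤n
turn≤2 (suc (suc j)) = turn≤2 j

below-parent₁ : ∀ v → parent₁ v < v → below (parent₁ v) v ≡ true
below-parent₁ v lt = ∧-intro (Equivalence.to T-≡ (<⇒<ᵇ lt)) (∨-introˡ (Equivalence.to T-≡ (≡⇒≡ᵇ (parent₁ v) _ refl)))

below-parent₂ : ∀ v → parent₂ v < v → below (parent₂ v) v ≡ true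
below-parent₂ v lt = ∧-intro (Equivalence.to T-≡ (<⇒<ᵇ lt))
    (∨-introʳ {parent₂ v ≡ᵇ parent₁ v} (Equivalence.to T-≡ (≡⇒≡ᵇ (parent₂ v) _ refl)))

module _ {N : ℕ} (P : ℕ → Bool) where
  private
    index-true : ∀ {a} (lt : a < N) → P a ≡ true → P (toℕ (fromℕ< lt)) ≡ true
    index-true lt e rewrite Fin.toℕ-fromℕ< lt = e
    index-≢ : ∀ {a b} (la : a < N) (lb : b < N) → a < b → fromℕ< la ≢ fromℕ< lb
    index-≢ la lb lt e = <⇒≢ lt (trans (sym (Fin.toℕ-fromℕ< la)) (trans (cong toℕ e) (Fin.toℕ-fromℕ< lb)))

  count-two : ∀ {a b} → a < b → b < N → P a ≡ true → P b ≡ true → 2 ≤ count {N} (P ∘ toℕ)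
  count-two ab lb ea eb =
    let la = <-trans ab lb in
    count-≥ {l = fromℕ< la ∷ fromℕ< lb ∷ []}
      ((index-≢ la lb ab ∷ []) ∷ [] ∷ []) (index-true la ea ∷ index-true lb eb ∷ [])

  count-three : ∀ {a b c} → a < b → b < c → c < N → P a ≡ true → P b ≡ true → P c ≡ true →
                3 ≤ count {N} (P ∘ toℕ)
  count-three ab bc lc ea eb ec =
    let lb = <-trans bc lc ; la = <-trans ab lb in
    count-≥ {l = fromℕ< la ∷ fromℕ< lb ∷ fromℕ< lc ∷ []}
      ((index-≢ la lb ab ∷ index-≢ la lc (<-trans ab bc) ∷ []) ∷ (index-≢ lb lc bc ∷ []) ∷ [] ∷ [])
      (index-true la ea ∷ index-true lb eb ∷ index-true lc ec ∷ [])

turn<10+ : ∀ j → turn j < 10 + j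
turn<10+ j = ≤-trans (s≤s (turn≤2 j)) (≤-trans (toWitness {a? = 3 ≤? 10} _) (m≤m+n 10 j))

linked-parent₁ : ∀ v → parent₁ v < v → linked v (parent₁ v) ≡ true
linked-parent₁ v lt = ∨-introʳ {below v (parent₁ v)} (below-parent₁ v lt)

linked-parent₂ : ∀ v → parent₂ v < v → linked v (parent₂ v) ≡ true
linked-parent₂ v lt = ∨-introʳ {below v (parent₂ v)} (below-parent₂ v lt)

H-degree≥3 : ∀ k (u : Fin (11 + k)) → toℕ u ≢ 10 + k → 3 ≤ degree (H k) u
H-degree≥3 k u u≢last = go (toℕ u) refl
  where
  three : ∀ {v a b c} → toℕ u ≡ v → a < b → b < c → c < 11 + k → linked v a ≡ true →
          linked v b ≡ true → linked v c ≡ true → 3 ≤ degree (H k) u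
  three refl = count-three (linked (toℕ u))
  small : ∀ {v} → toℕ u ≡ v → ∀ a b c → {_ : True (a <? b)} {_ : True (b <? c)} {_ : True (c <? 11)} →
          linked v a ≡ true → linked v b ≡ true → linked v c ≡ true → 3 ≤ degree (H k) u
  small e a b c {p} {q} {r} = three e (toWitness p) (toWitness q) (≤-trans (toWitness r) (m≤m+n 11 k))
  next : ∀ j → linked (10 + j) (11 + j) ≡ true
  next j = ∨-introˡ (below-parent₁ (11 + j) ≤-refl)
  room : ∀ j → toℕ u ≡ 10 + j → 11 + j < 11 + k
  room j e = ≤∧≢⇒< (subst (_< 11 + k) e (Fin.toℕ<n u)) (λ q → u≢last (trans e (suc-injective q)))
  go : ∀ t → toℕ u ≡ t → 3 ≤ degree (H k) u
  go 0 e = small e 1 2 5 refl refl refl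
  go 1 e = small e 0 3 4 refl refl refl
  go 2 e = small e 0 3 4 refl refl refl
  go 3 e = small e 1 2 5 refl refl refl
  go 4 e = small e 1 2 10 refl refl refl
  go 5 e = small e 0 3 7 refl refl refl
  go 6 e = small e 0 7 9 refl refl refl
  go 7 e = small e 5 6 8 refl refl refl
  go 8 e = small e 0 7 9 refl refl refl
  go 9 e = small e 6 8 10 refl refl refl
  -- From vertex 10 on there are two distinct parents, and the third neighbour is the successor,
  -- which exists because `u` is not the last vertex.
  go 10 e = three e (toWitness {a? = 4 <? 9} _) (toWitness {a? = 9 <? 11} _) (room 0 e) refl refl (next 0)
  go (suc (suc (suc (suc (suc (suc (suc (suc (suc (suc (suc j))))))))))) e =
    three e (turn<10+ j) (s≤s (n≤1+n _)) (room (suc j) e)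
      (linked-parent₂ (11 + j) (m<n⇒m<1+n (turn<10+ j)))
      (linked-parent₁ (11 + j) ≤-refl) (next (suc j))

-- The last vertex is nobody's parent, and its own two parents are distinct.
H-last : ∀ k (u : Fin (11 + k)) → toℕ u ≡ 10 + k → degree (H k) u ≡ 2
H-last k u e = ≤-antisym upper (lower k u e)
  where
  nbr : ∀ i → adj (H k) u i ≡ true → is (parent₁ (toℕ u)) i ≡ true ⊎ is (parent₂ (toℕ u)) i ≡ true
  nbr i q with ∨-elim {below (toℕ u) (toℕ i)} q
  ... | inj₁ h = ⊥-elim (<⇒≱ (below⇒< (toℕ u) _ h) (subst (toℕ i ≤_) (sym e) (≤-pred (Fin.toℕ<n i))))
  ... | inj₂ h = is-parent i (toℕ u) h
  upper : degree (H k) u ≤ 2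
  upper = ≤-trans (count-∪ nbr) (+-mono-≤ (count-is (11 + k) (parent₁ (toℕ u))) (count-is (11 + k) (parent₂ (toℕ u))))
  two : ∀ {k v a b} (u : Fin (11 + k)) → toℕ u ≡ v → a < b → b < 11 + k → linked v a ≡ true →
        linked v b ≡ true → 2 ≤ degree (H k) u
  two u refl = count-two (linked (toℕ u))
  lower : ∀ k (u : Fin (11 + k)) → toℕ u ≡ 10 + k → 2 ≤ degree (H k) u
  lower zero    u e = two u e (toWitness {a? = 4 <? 9} _) (toWitness {a? = 9 <? 11} _) refl refl
  lower (suc j) u e = two u e (turn<10+ j) (n≤1+n (11 + j))
    (linked-parent₂ (11 + j) (m<n⇒m<1+n (turn<10+ j))) (linked-parent₁ (11 + j) ≤-refl)

H-critical : ∀ k → CriticalDegenerate 2 (H k)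
H-critical k = H-degenerate k , last , H-last k last toℕ-last ,
  λ u u≢ → H-degree≥3 k u (λ e → u≢ (Fin.toℕ-injective (trans e (sym toℕ-last))))
  where
  last : Fin (11 + k)
  last = fromℕ< {10 + k} ≤-refl
  toℕ-last : toℕ last ≡ 10 + k
  toℕ-last = Fin.toℕ-fromℕ< ≤-refl

-- The number of vertices already separates the members of the family.
isomorphic⇒size : ∀ G G′ → Isomorphic G G′ → size G ≡ size G′
isomorphic⇒size G G′ (f , g , gf , fg , _) = ≤-antisym
  (Fin.injective⇒≤ {f = f} (λ {i} {j} e → trans (sym (gf i)) (trans (cong g e) (gf j))))
  (Fin.injective⇒≤ {f = g} (λ {i} {j} e → trans (sym (fg i)) (trans (cong f e) (fg j))))

-- Counting ordered triples.

count-unique : {p : Fin n → Bool} → (∀ i j → p i ≡ true → p j ≡ true → i ≡ j) → count p ≤ 1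
count-unique {p = p} h with Fin.any? (λ i → p i Bool.≟ true)
... | yes (i , e) = count-single i (λ j q → h j i q e)
... | no ¬x = ≤-trans (≤-reflexive (count-none (λ i e → ¬x (i , e)))) z≤n

count-strict : {p q : Fin n → Bool} → (∀ i → p i ≡ true → q i ≡ true) → ∀ x →
               p x ≡ false → q x ≡ true → suc (count p) ≤ count q
count-strict {p = p} {q} h x px qx = ≤-trans (s≤s (count-mono keep)) (count-erase x qx)
  where
  keep : ∀ i → p i ≡ true → q i ∧ not (does (i Fin.≟ x)) ≡ true
  keep i e with i Fin.≟ x
  ... | yes refl = ⊥-elim (true≢false e px)
  ... | no _     = ∧-intro (h i e) refl

vol : (Fin m → Fin m → Fin m → Bool) → ℕ
vol f = sumFin (λ a → sumFin (λ b → count (f a b)))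

vol-rotate : (f : Fin m → Fin m → Fin m → Bool) → vol f ≡ vol (λ b c a → f a b c)
vol-rotate f = trans (sum-swap (λ a b → count (f a b))) (sum-cong λ b →
  trans (sum-cong (λ a → count≡sum (f a b)))
    (trans (sum-swap (λ a c → ind (f a b c))) (sum-cong λ c → sym (count≡sum (λ a → f a b c)))))

-- For charging triples to their pairs: `h` collects the triples whose first pair is defective, and
-- a triple of `f` outside `g` has a defect at one of its three pairs. Rotation preserves `vol`,
-- whence the factor 3.
vol-split : {f g h : Fin m → Fin m → Fin m → Bool} →
            (∀ a b c → f a b c ≡ true →
              g a b c ≡ true ⊎ (h a b c ≡ true ⊎ (h b c a ≡ true ⊎ h c a b ≡ true))) →
            vol f ≤ vol g + 3 * vol h
vol-split {f = f} {g} {h} s = begin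
  vol f
    ≤⟨ ∪-vol g (λ a b c → h a b c ∨ (h b c a ∨ h c a b)) (λ a b c e → or (s a b c e)) ⟩
  vol g + vol (λ a b c → h a b c ∨ (h b c a ∨ h c a b))
    ≤⟨ +-monoʳ-≤ (vol g) (∪-vol h (λ a b c → h b c a ∨ h c a b) (λ a b c → ∨-elim)) ⟩
  vol g + (vol h + vol (λ a b c → h b c a ∨ h c a b))
    ≤⟨ +-monoʳ-≤ (vol g) (+-monoʳ-≤ (vol h) (∪-vol (λ a b c → h b c a) (λ a b c → h c a b) (λ a b c → ∨-elim))) ⟩
  vol g + (vol h + (vol (λ a b c → h b c a) + vol (λ a b c → h c a b)))
    ≡⟨ cong (λ w → vol g + (vol h + w)) (cong₂ _+_ rot₁ rot₂) ⟩
  vol g + (vol h + (vol h + vol h))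
    ≡⟨ cong (λ w → vol g + (vol h + (vol h + w))) (sym (+-identityʳ (vol h))) ⟩
  vol g + 3 * vol h ∎
  where
  open ≤-Reasoning
  or : ∀ {a b c d} → a ≡ true ⊎ (b ≡ true ⊎ (c ≡ true ⊎ d ≡ true)) → a ≡ true ⊎ b ∨ (c ∨ d) ≡ true
  or (inj₁ e) = inj₁ e
  or (inj₂ (inj₁ e)) = inj₂ (∨-introˡ e)
  or {b = b} (inj₂ (inj₂ (inj₁ e))) = inj₂ (∨-introʳ {b} (∨-introˡ e))
  or {b = b} {c} (inj₂ (inj₂ (inj₂ e))) = inj₂ (∨-introʳ {b} (∨-introʳ {c} e))
  ∪-vol : ∀ {f} g h → (∀ a b c → f a b c ≡ true → g a b c ≡ true ⊎ h a b c ≡ true) →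
          vol f ≤ vol g + vol h
  ∪-vol g h s = ≤-trans
    (sum-mono λ a → ≤-trans (sum-mono λ b → count-∪ (s a b)) (≤-reflexive (sum-+ (λ b → count (g a b)) _)))
    (≤-reflexive (sum-+ (λ a → sumFin (λ b → count (g a b))) _))
  rot₂ : vol (λ a b c → h c a b) ≡ vol h
  rot₂ = sym (vol-rotate h)
  rot₁ : vol (λ a b c → h b c a) ≡ vol h
  rot₁ = vol-rotate (λ a b c → h b c a)

∈? : (x : Fin n) (l : List (Fin n)) → Dec (x ∈ l)
∈? x l = Any.any? (x Fin.≟_) l

count-∈? : (l : List (Fin n)) → count (λ i → does (∈? i l)) ≤ length l
count-∈? l = count-∈ l (λ i → does-true (∈? i l))

-- Otherwise `w`, `a`, `b`, `c` would be four distinct members of a list of length at most 3.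
three-cover : {l : List (Fin n)} → length l ≤ 3 → {a b c : Fin n} → a ≢ b → a ≢ c → b ≢ c →
              a ∈ l → b ∈ l → c ∈ l → ∀ {w} → w ∈ l → w ≡ a ⊎ (w ≡ b ⊎ w ≡ c)
three-cover {l = l} short {a} {b} {c} ab ac bc al bl cl {w} wl with w Fin.≟ a | w Fin.≟ b | w Fin.≟ c
... | yes e | _     | _     = inj₁ e
... | no _  | yes e | _     = inj₂ (inj₁ e)
... | no _  | no _  | yes e = inj₂ (inj₂ e)
... | no wa | no wb | no wc = ⊥-elim (<⇒≱ {3} {4} ≤-refl (≤-trans
  (count-≥ {p = λ i → does (∈? i l)} {l = w ∷ a ∷ b ∷ c ∷ []}
    ((wa ∷ wb ∷ wc ∷ []) ∷ (ab ∷ ac ∷ []) ∷ (bc ∷ []) ∷ [] ∷ [])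
    (dec-true (∈? w l) wl ∷ dec-true (∈? a l) al ∷ dec-true (∈? b l) bl ∷ dec-true (∈? c l) cl ∷ []))
  (≤-trans (count-∈? l) short)))

-- Cores of an incidence structure between labels and points.

module Link {n m : ℕ} (I : Fin n → Fin m → Bool) (pt : Fin m → Fin n)
            (pt-inj : ∀ i j → pt i ≡ pt j → i ≡ j) (M : ℕ) (6≤M : 6 ≤ M) where

  -- The pair b, x can be continued j times by a label of b, x, x′ and the point x′, avoiding any
  -- M used vertices.
  Ext : ℕ → Fin m → Fin m → Set
  Ext zero    b x = ⊤
  Ext (suc j) b x = (used : List (Fin n)) → length used ≤ M →
    Σ (Fin m) λ x′ → Σ (Fin n) λ y → pt x′ ∉ used × y ∉ used ×
    I y b ≡ true × I y x ≡ true × I y x′ ≡ true × Ext j b x′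

  -- The triples abc, abc′, ca′b′, a′b′c′ with labels y, z, y′, z′.
  record Core (i : ℕ) : Set where
    field
      a b c a′ b′ c′ : Fin m
      y z y′ z′      : Fin n
      points : AllPairs _≢_ (a ∷ b ∷ c ∷ a′ ∷ b′ ∷ c′ ∷ [])
      labels : AllPairs _≢_ (y ∷ z ∷ y′ ∷ z′ ∷ [])
      ya : I y a ≡ true
      yb : I y b ≡ true
      yc : I y c ≡ true
      za : I z a ≡ true
      zb : I z b ≡ true
      zc′ : I z c′ ≡ true
      y′c : I y′ c ≡ true
      y′a′ : I y′ a′ ≡ true
      y′b′ : I y′ b′ ≡ true
      z′a′ : I z′ a′ ≡ true
      z′b′ : I z′ b′ ≡ true
      z′c′ : I z′ c′ ≡ true
      ext : Ext i b c′

  common : Fin m → Fin m → Fin m → Fin n → Bool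
  common a b c y = I y a ∧ (I y b ∧ I y c)

  count-pt : ∀ u → count (λ x → does (pt x Fin.≟ u)) ≤ 1
  count-pt u = count-unique λ i j p q →
    pt-inj i j (trans (does-true (pt i Fin.≟ u) p) (sym (does-true (pt j Fin.≟ u) q)))

  thick-core : ∀ i (S : Fin m → Bool) → 2 + M < count S →
    (∀ a b c → S a ≡ true → S b ≡ true → S c ≡ true → a ≢ b → a ≢ c → b ≢ c →
      M < count (common a b c)) → Core i
  thick-core i S big thick =
    let a  , Sa  , na  = point [] _
        b  , Sb  , nb  = point (a ∷ []) _
        c  , Sc  , nc  = point (b ∷ a ∷ []) _
        a′ , Sa′ , na′ = point (c ∷ b ∷ a ∷ []) _
        b′ , Sb′ , nb′ = point (a′ ∷ c ∷ b ∷ a ∷ []) _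
        c′ , Sc′ , nc′ = point (b′ ∷ a′ ∷ c ∷ b ∷ a ∷ []) _
        y  , hy  , ny  = label [] _ (thick a b c Sa Sb Sc (nb ∘ at₀ ∘ sym) (nc ∘ at₁ ∘ sym) (nc ∘ at₀ ∘ sym))
        z  , hz  , nz  = label (y ∷ []) _ (thick a b c′ Sa Sb Sc′ (nb ∘ at₀ ∘ sym) (nc′ ∘ at₄ ∘ sym) (nc′ ∘ at₃ ∘ sym))
        y′ , hy′ , ny′ = label (z ∷ y ∷ []) _ (thick c a′ b′ Sc Sa′ Sb′ (na′ ∘ at₀ ∘ sym) (nb′ ∘ at₁ ∘ sym) (nb′ ∘ at₀ ∘ sym))
        z′ , hz′ , nz′ = label (y′ ∷ z ∷ y ∷ []) _ (thick a′ b′ c′ Sa′ Sb′ Sc′ (nb′ ∘ at₀ ∘ sym) (nc′ ∘ at₁ ∘ sym) (nc′ ∘ at₀ ∘ sym))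
    in record
      { a = a ; b = b ; c = c ; a′ = a′ ; b′ = b′ ; c′ = c′ ; y = y ; z = z ; y′ = y′ ; z′ = z′
      ; points = ((nb ∘ at₀ ∘ sym) ∷ (nc ∘ at₁ ∘ sym) ∷ (na′ ∘ at₂ ∘ sym) ∷ (nb′ ∘ at₃ ∘ sym) ∷ (nc′ ∘ at₄ ∘ sym) ∷ [])
               ∷ ((nc ∘ at₀ ∘ sym) ∷ (na′ ∘ at₁ ∘ sym) ∷ (nb′ ∘ at₂ ∘ sym) ∷ (nc′ ∘ at₃ ∘ sym) ∷ [])
               ∷ ((na′ ∘ at₀ ∘ sym) ∷ (nb′ ∘ at₁ ∘ sym) ∷ (nc′ ∘ at₂ ∘ sym) ∷ [])
               ∷ ((nb′ ∘ at₀ ∘ sym) ∷ (nc′ ∘ at₁ ∘ sym) ∷ [])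
               ∷ ((nc′ ∘ at₀ ∘ sym) ∷ []) ∷ [] ∷ []
      ; labels = ((nz ∘ at₀ ∘ sym) ∷ (ny′ ∘ at₁ ∘ sym) ∷ (nz′ ∘ at₂ ∘ sym) ∷ [])
               ∷ ((ny′ ∘ at₀ ∘ sym) ∷ (nz′ ∘ at₁ ∘ sym) ∷ [])
               ∷ ((nz′ ∘ at₀ ∘ sym) ∷ []) ∷ [] ∷ []
      ; ya = ∧-left hy ; yb = ∧-left (∧-right {I y a} hy) ; yc = ∧-right {I y b} (∧-right {I y a} hy)
      ; za = ∧-left hz ; zb = ∧-left (∧-right {I z a} hz) ; zc′ = ∧-right {I z b} (∧-right {I z a} hz)
      ; y′c = ∧-left hy′ ; y′a′ = ∧-left (∧-right {I y′ c} hy′) ; y′b′ = ∧-right {I y′ a′} (∧-right {I y′ c} hy′)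
      ; z′a′ = ∧-left hz′ ; z′b′ = ∧-left (∧-right {I z′ a′} hz′) ; z′c′ = ∧-right {I z′ b′} (∧-right {I z′ a′} hz′)
      ; ext = extend i b c′ Sb Sc′ (nc′ ∘ at₃ ∘ sym)
      }
    where
    at₀ : ∀ {A : Set} {x u : A} {l} → x ≡ u → x ∈ u ∷ l
    at₀ = here
    at₁ : ∀ {A : Set} {x u v : A} {l} → x ≡ u → x ∈ v ∷ u ∷ l
    at₁ = there ∘ here
    at₂ : ∀ {A : Set} {x u v w : A} {l} → x ≡ u → x ∈ v ∷ w ∷ u ∷ l
    at₂ = there ∘ at₁
    at₃ : ∀ {A : Set} {x u v w s : A} {l} → x ≡ u → x ∈ v ∷ w ∷ s ∷ u ∷ l
    at₃ = there ∘ at₂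
    at₄ : ∀ {A : Set} {x u v w s t : A} {l} → x ≡ u → x ∈ v ∷ w ∷ s ∷ t ∷ u ∷ l
    at₄ = there ∘ at₃
    point : (l : List (Fin m)) → True (length l ≤? 6) → ∃ λ x → S x ≡ true × x ∉ l
    point l t = count-fresh l (≤-<-trans (≤-trans (toWitness t) (≤-trans 6≤M (m≤n+m M 2))) big)
    label : (l : List (Fin n)) → True (length l ≤? 6) → {p : Fin n → Bool} → M < count p →
            ∃ λ x → p x ≡ true × x ∉ l
    label l t h = count-fresh l (≤-<-trans (≤-trans (toWitness t) 6≤M) h)
    extend : ∀ j b x → S b ≡ true → S x ≡ true → b ≢ x → Ext j b x
    extend zero    b x Sb Sx b≢x = tt
    -- Adding `pt b` and `pt x` to the avoided vertices makes `b`, `x`, `x′` distinct, so that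
    -- thickness applies to them.
    extend (suc j) b x Sb Sx b≢x used short =
      let x′ , Sx′ , avoids = count-avoid (λ u i → does (pt i Fin.≟ u)) 1 count-pt (pt b ∷ pt x ∷ used)
            (≤-<-trans (≤-trans (≤-reflexive (*-identityˡ _)) (s≤s (s≤s short))) big)
          new : pt x′ ∉ pt b ∷ pt x ∷ used
          new k = true≢false (dec-true (pt x′ Fin.≟ pt x′) refl) (avoids k)
          b≢x′ : b ≢ x′
          b≢x′ e = new (here (cong pt (sym e)))
          x≢x′ : x ≢ x′
          x≢x′ e = new (there (here (cong pt (sym e))))
          y , hy , ny = count-fresh used (≤-<-trans short (thick b x x′ Sb Sx Sx′ b≢x b≢x′ x≢x′))
      in x′ , y , (λ k → new (there (there k))) , ny , ∧-left hy , ∧-left (∧-right {I y b} hy) ,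
         ∧-right {I y x} (∧-right {I y b} hy) , extend j b x′ Sb Sx′ b≢x′

-- The coefficient of `m * m` in `incidences`: 3 points are accounted for by each triple, at most
-- `M` labels share a triple, `vol-R` contributes 39, and each level of `Tri` loses at most `6 * M`
-- triples per ordered pair.
density : ℕ → ℕ → ℕ
density M steps = 3 * (M * (39 + steps * (6 * M)))

-- Few incidences in the absence of a core.

module CoreFree {n m : ℕ} (I : Fin n → Fin m → Bool) (pt : Fin m → Fin n)
                (pt-inj : ∀ i j → pt i ≡ pt j → i ≡ j) (M : ℕ) (6≤M : 6 ≤ M)
                (steps : ℕ) (no-core : ¬ Link.Core I pt pt-inj M 6≤M steps) where
  open Link I pt pt-inj M 6≤M

  -- A family of disjoint triples in `S`, stored as the relation of all their orderings: `swap` and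
  -- `rotate` generate the permutations, and `unique` expresses that a point lies in one block only.
  -- By `large` the blocks cover `S` up to `2 + M` points.
  record Packing (S : Fin m → Bool) : Set where
    field
      tl      : Fin m → Fin m → Fin m → Bool
      swap    : ∀ {a b c} → tl a b c ≡ true → tl b a c ≡ true
      rotate  : ∀ {a b c} → tl a b c ≡ true → tl b c a ≡ true
      apart   : ∀ {a b c} → tl a b c ≡ true → a ≢ b
      inside  : ∀ {a b c} → tl a b c ≡ true → S a ≡ true
      thin    : ∀ {a b c} → tl a b c ≡ true → count (common a b c) ≤ M
      unique  : ∀ {a b c b′ c′} → tl a b c ≡ true → tl a b′ c′ ≡ true → b′ ≡ b ⊎ b′ ≡ c
      large   : count S ≤ 2 + M + 3 * vol tl

  -- A finite search; if it fails, `S` satisfies the hypothesis of `thick-core`, which is excluded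
  -- by `no-core`.
  thin-triple : (S : Fin m → Bool) → 2 + M < count S →
    Σ (Fin m) λ a → Σ (Fin m) λ b → Σ (Fin m) λ c → S a ≡ true × S b ≡ true × S c ≡ true ×
    a ≢ b × a ≢ c × b ≢ c × count (common a b c) ≤ M
  thin-triple S big with Fin.any? (λ a → Fin.any? (λ b → Fin.any? (λ c →
      (S a Bool.≟ true) ×-dec (S b Bool.≟ true) ×-dec (S c Bool.≟ true) ×-dec
      ¬? (a Fin.≟ b) ×-dec ¬? (a Fin.≟ c) ×-dec ¬? (b Fin.≟ c) ×-dec (count (common a b c) ≤? M))))
  ... | yes t = t
  ... | no ¬t = ⊥-elim (no-core (thick-core steps S big λ a b c Sa Sb Sc ab ac bc →
                  ≰⇒> λ le → ¬t (a , b , c , Sa , Sb , Sc , ab , ac , bc , le)))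

  grow : (S : Fin m → Bool) {a b c : Fin m} → S a ≡ true → S b ≡ true → S c ≡ true →
         a ≢ b → a ≢ c → b ≢ c → count (common a b c) ≤ M →
         Packing (λ i → S i ∧ not (does (∈? i (a ∷ b ∷ c ∷ [])))) → Packing S
  grow S {a₀} {b₀} {c₀} Sa Sb Sc ab ac bc th P = record
    { tl     = tl
    ; swap   = λ {a} {b} {c} → swp a b c ∘ ∨-elim
    ; rotate = λ {a} {b} {c} → rot a b c ∘ ∨-elim
    ; apart  = λ {a} {b} {c} e →
        [ (λ q → let (_ , _ , _ , x , _) = old a b c q in x) , P.apart ]′ (∨-elim e)
    ; inside = λ {a} {b} {c} e →
        [ (λ q → All.lookup (Sa ∷ Sb ∷ Sc ∷ []) (proj₁ (old a b c q))) , ∧-left ∘ P.inside ]′ (∨-elim e)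
    ; thin   = λ {a} {b} {c} e → [ thin-new a b c , P.thin ]′ (∨-elim e)
    ; unique = λ {a} {b} {c} {b′} {c′} e f → uniq a b c b′ c′ (∨-elim e) (∨-elim f)
    ; large  = bound
    }
    where
    module P = Packing P
    l : List (Fin m)
    l = a₀ ∷ b₀ ∷ c₀ ∷ []
    New : Fin m → Fin m → Fin m → Set
    New a b c = a ∈ l × b ∈ l × c ∈ l × a ≢ b × a ≢ c × b ≢ c
    New? : ∀ a b c → Dec (New a b c)
    New? a b c = ∈? a l ×-dec ∈? b l ×-dec ∈? c l ×-dec
                 ¬? (a Fin.≟ b) ×-dec ¬? (a Fin.≟ c) ×-dec ¬? (b Fin.≟ c)
    old : ∀ a b c → does (New? a b c) ≡ true → New a b c
    old a b c = does-true (New? a b c)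
    new : ∀ a b c → New a b c → does (New? a b c) ≡ true
    new a b c = dec-true (New? a b c)
    tl : Fin m → Fin m → Fin m → Bool
    tl a b c = does (New? a b c) ∨ P.tl a b c
    swp : ∀ a b c → does (New? a b c) ≡ true ⊎ P.tl a b c ≡ true → tl b a c ≡ true
    swp a b c (inj₂ q) = ∨-introʳ {does (New? b a c)} (P.swap q)
    swp a b c (inj₁ q) = let (al , bl , cl , x , y , z) = old a b c q in
      ∨-introˡ (new b a c (bl , al , cl , x ∘ sym , z , y))
    rot : ∀ a b c → does (New? a b c) ≡ true ⊎ P.tl a b c ≡ true → tl b c a ≡ true
    rot a b c (inj₂ q) = ∨-introʳ {does (New? b c a)} (P.rotate q)
    rot a b c (inj₁ q) = let (al , bl , cl , x , y , z) = old a b c q in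
      ∨-introˡ (new b c a (bl , cl , al , z , x ∘ sym , y ∘ sym))
    outside : ∀ {a b c} → P.tl a b c ≡ true → a ∉ l
    outside {a} e k = true≢false (dec-true (∈? a l) k) (not-true (∧-right {S a} (P.inside e)))
    covered : ∀ a b c → New a b c → ∀ {w} → w ∈ l → w ≡ a ⊎ (w ≡ b ⊎ w ≡ c)
    covered a b c (al , bl , cl , x , y , z) = three-cover {l = l} ≤-refl x y z al bl cl
    -- Every ordering of the new block has the same common labels as `a₀`, `b₀`, `c₀`.
    thin-new : ∀ a b c → does (New? a b c) ≡ true → count (common a b c) ≤ M
    thin-new a b c q = ≤-trans (count-mono transfer) th
      where
      move : ∀ {y} → common a b c y ≡ true → ∀ {w} → w ∈ l → I y w ≡ true
      move {y} e k with covered a b c (old a b c q) k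
      ... | inj₁ refl        = ∧-left e
      ... | inj₂ (inj₁ refl) = ∧-left (∧-right {I y a} e)
      ... | inj₂ (inj₂ refl) = ∧-right {I y b} (∧-right {I y a} e)
      transfer : ∀ y → common a b c y ≡ true → common a₀ b₀ c₀ y ≡ true
      transfer y e = ∧-intro (move e (here refl)) (∧-intro (move e (there (here refl))) (move e (there (there (here refl)))))
    -- The blocks of `P` avoid `l`, so two blocks through one point are both old or both the new
    -- one.
    uniq : ∀ a b c b′ c′ → does (New? a b c) ≡ true ⊎ P.tl a b c ≡ true →
           does (New? a b′ c′) ≡ true ⊎ P.tl a b′ c′ ≡ true → b′ ≡ b ⊎ b′ ≡ c
    uniq a b c b′ c′ (inj₁ e) (inj₂ f) = ⊥-elim (outside f (proj₁ (old a b c e)))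
    uniq a b c b′ c′ (inj₂ e) (inj₁ f) = ⊥-elim (outside e (proj₁ (old a b′ c′ f)))
    uniq a b c b′ c′ (inj₂ e) (inj₂ f) = P.unique e f
    uniq a b c b′ c′ (inj₁ e) (inj₁ f) with old a b′ c′ f
    ... | _ , b′l , _ , a≢b′ , _ with covered a b c (old a b c e) b′l
    ... | inj₁ q = ⊥-elim (a≢b′ (sym q))
    ... | inj₂ q = q
    weaker : ∀ a b c → P.tl a b c ≡ true → tl a b c ≡ true
    weaker a b c e = ∨-introʳ {does (New? a b c)} e
    -- The new block adds six ordered triples; one of them is enough to pay for its three points.
    more : suc (vol P.tl) ≤ vol tl
    more = sum-strict (λ a → sum-mono (λ b → count-mono (weaker a b))) a₀
             (sum-strict (λ b → count-mono (weaker a₀ b)) b₀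
               (count-strict (weaker a₀ b₀) c₀ fresh
                 (∨-introˡ (new a₀ b₀ c₀ (here refl , there (here refl) , there (there (here refl)) , ab , ac , bc)))))
      where
      fresh : P.tl a₀ b₀ c₀ ≡ false
      fresh with true-or-false (P.tl a₀ b₀ c₀)
      ... | inj₁ e = ⊥-elim (outside e (here refl))
      ... | inj₂ e = e
    bound : count S ≤ 2 + M + 3 * vol tl
    bound = begin
      count S ≤⟨ count-∪ split ⟩
      count (λ i → does (∈? i l)) + count (λ i → S i ∧ not (does (∈? i l))) ≤⟨ +-mono-≤ (count-∈? l) P.large ⟩
      3 + (2 + M + 3 * vol P.tl) ≡⟨ +-assoc 3 (2 + M) _ ⟨
      3 + (2 + M) + 3 * vol P.tl ≡⟨ cong (_+ 3 * vol P.tl) (+-comm 3 (2 + M)) ⟩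
      2 + M + 3 + 3 * vol P.tl ≡⟨ +-assoc (2 + M) 3 _ ⟩
      2 + M + (3 + 3 * vol P.tl) ≡⟨ cong (2 + M +_) (*-suc 3 (vol P.tl)) ⟨
      2 + M + 3 * suc (vol P.tl) ≤⟨ +-monoʳ-≤ (2 + M) (*-monoʳ-≤ 3 more) ⟩
      2 + M + 3 * vol tl ∎
      where
      open ≤-Reasoning
      split : ∀ i → S i ≡ true → does (∈? i l) ≡ true ⊎ S i ∧ not (does (∈? i l)) ≡ true
      split i e with does (∈? i l)
      ... | true  = inj₁ refl
      ... | false = inj₂ (∧-intro e refl)

  -- Thin triples are removed greedily while more than `2 + M` points remain. The fuel bounds the
  -- number of remaining points, so it cannot run out first.
  packing : ∀ fuel (S : Fin m → Bool) → count S ≤ fuel → Packing S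
  packing fuel S le with count S ≤? 2 + M
  ... | yes small = record
    { tl = λ _ _ _ → false ; swap = λ () ; rotate = λ () ; apart = λ () ; inside = λ ()
    ; thin = λ () ; unique = λ () ; large = ≤-trans small (m≤m+n (2 + M) _) }
  packing zero S le       | no big = ⊥-elim (big (≤-trans le z≤n))
  packing (suc fuel) S le | no big with thin-triple S (≰⇒> big)
  ... | a , b , c , Sa , Sb , Sc , ab , ac , bc , th =
    grow S Sa Sb Sc ab ac bc th (packing fuel _ (≤-pred (≤-trans fewer le)))
    where
    fewer : count (λ i → S i ∧ not (does (∈? i (a ∷ b ∷ c ∷ [])))) < count S
    fewer = count-strict (λ i → ∧-left) a
      (trans (cong (λ w → S a ∧ not w) (dec-true (∈? a (a ∷ b ∷ c ∷ [])) (here refl))) (∧-zeroʳ (S a))) Sa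

  tl : Fin n → Fin m → Fin m → Fin m → Bool
  tl y = Packing.tl (packing _ (I y) ≤-refl)

  module Tl (y : Fin n) = Packing (packing _ (I y) ≤-refl)

  -- The threshold is `2 * M` because each of at most `M` used vertices can spoil two third points:
  -- itself as a point, and the one whose triple it labels.
  rich : (Fin m → Fin m → Fin m → Bool) → Fin m → Fin m → Bool
  rich R a b = does (2 * M <? count (R a b))

  -- Tri⇒Ext uses up one level of richness for each step of Ext.
  Tri : ℕ → Fin m → Fin m → Fin m → Bool
  Tri zero    a b c = does (Fin.any? (λ y → tl y a b c Bool.≟ true))
  Tri (suc j) a b c = Tri j a b c ∧ (rich (Tri j) a b ∧ (rich (Tri j) b c ∧ rich (Tri j) c a))

  label : ∀ j {a b c} → Tri j a b c ≡ true → ∃ λ y → tl y a b c ≡ true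
  label zero    {a} {b} {c} e = does-true (Fin.any? (λ y → tl y a b c Bool.≟ true)) e
  label (suc j) e = label j (∧-left e)

  rich-swap : ∀ {R} → (∀ {a b c} → R a b c ≡ true → R b a c ≡ true) →
              ∀ a b → rich R a b ≡ true → rich R b a ≡ true
  rich-swap {R} s a b e = dec-true (2 * M <? count (R b a))
    (<-≤-trans (does-true (2 * M <? count (R a b)) e) (count-mono {p = R a b} {q = R b a} (λ c → s)))

  Tri-swap : ∀ j {a b c} → Tri j a b c ≡ true → Tri j b a c ≡ true
  Tri-swap zero {a} {b} {c} e = let y , q = label 0 e in
    dec-true (Fin.any? (λ y → tl y b a c Bool.≟ true)) (y , Tl.swap y q)
  Tri-swap (suc j) {a} {b} {c} e =
    let q = ∧-right {Tri j a b c} e ; q′ = ∧-right {rich (Tri j) a b} q in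
    ∧-intro (Tri-swap j (∧-left e)) (∧-intro (rich-swap (Tri-swap j) a b (∧-left q))
      (∧-intro (rich-swap (Tri-swap j) c a (∧-right {rich (Tri j) b c} q′))
               (rich-swap (Tri-swap j) b c (∧-left q′))))

  Tri-rotate : ∀ j {a b c} → Tri j a b c ≡ true → Tri j b c a ≡ true
  Tri-rotate zero {a} {b} {c} e = let y , q = label 0 e in
    dec-true (Fin.any? (λ y → tl y b c a Bool.≟ true)) (y , Tl.rotate y q)
  Tri-rotate (suc j) {a} {b} {c} e =
    let q = ∧-right {Tri j a b c} e ; q′ = ∧-right {rich (Tri j) a b} q in
    ∧-intro (Tri-rotate j (∧-left e))
      (∧-intro {rich (Tri j) b c} (∧-left q′)
        (∧-intro {rich (Tri j) c a} (∧-right {rich (Tri j) b c} q′) (∧-left {rich (Tri j) a b} q)))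

  Tri-apart : ∀ j {a b c} → Tri j a b c ≡ true → a ≢ b
  Tri-apart j e = let y , q = label j e in Tl.apart y q

  Tri⇒Ext : ∀ j {a b x} → Tri j a b x ≡ true → Ext j b x
  Tri⇒Ext zero e = tt
  Tri⇒Ext (suc j) {a} {b} {x} e used short =
    let x′ , t , avoids = count-avoid {p = Tri j b x} bad 2 bad≤2 used
          (≤-<-trans (*-monoʳ-≤ 2 short) (does-true (2 * M <? count (Tri j b x))
            (∧-left (∧-right {rich (Tri j) a b} (∧-right {Tri j a b x} e)))))
        y , q = label j t
    in x′ , y ,
       (λ k → true≢false (∨-introˡ (dec-true (pt x′ Fin.≟ pt x′) refl)) (avoids k)) ,
       (λ k → true≢false (∨-introʳ {does (pt x′ Fin.≟ y)} q) (avoids k)) ,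
       Tl.inside y q , Tl.inside y (Tl.rotate y q) , Tl.inside y (Tl.rotate y (Tl.rotate y q)) ,
       Tri⇒Ext j (Tri-swap j t)
    where
    bad : Fin n → Fin m → Bool
    bad u x′ = does (pt x′ Fin.≟ u) ∨ tl u b x x′
    bad≤2 : ∀ u → count (bad u) ≤ 2
    bad≤2 u = ≤-trans (count-∪ {q = λ x′ → does (pt x′ Fin.≟ u)} {r = tl u b x} (λ i → ∨-elim))
                (+-mono-≤ (count-pt u) (count-unique same))
      where
      same : ∀ i j → tl u b x i ≡ true → tl u b x j ≡ true → i ≡ j
      same i j p q with Tl.unique u (flip q) (flip p)
        where flip : ∀ {i} → tl u b x i ≡ true → tl u b i x ≡ true
              flip q = Tl.rotate u (Tl.swap u q)
      ... | inj₁ e = e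
      ... | inj₂ e = ⊥-elim (Tl.apart u (Tl.rotate u p) (sym e))

  -- Füredi's argument: two pairs completed by the same two points.

  partners : Fin n → Fin m → List (Fin m)
  partners y c with Fin.any? (λ a → Fin.any? (λ b → tl y c a b Bool.≟ true))
  ... | yes (a , b , _) = a ∷ b ∷ []
  ... | no _            = []

  length-partners : ∀ y c → length (partners y c) ≤ 2
  length-partners y c with Fin.any? (λ a → Fin.any? (λ b → tl y c a b Bool.≟ true))
  ... | yes _ = ≤-refl
  ... | no _  = z≤n

  ∈-partners : ∀ y c {a b} → tl y c a b ≡ true → a ∈ partners y c
  ∈-partners y c {a} {b} e with Fin.any? (λ a → Fin.any? (λ b → tl y c a b Bool.≟ true))
  ... | no ¬x = ⊥-elim (¬x (a , b , e))
  ... | yes (_ , _ , q) with Tl.unique y q e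
  ... | inj₁ r = here r
  ... | inj₂ r = there (here r)

  R : Fin m → Fin m → Fin m → Bool
  R = Tri steps

  -- Two disjoint pairs forming triples with both c and c′ would give a core, unless a label is
  -- shared by two disjoint triples; adding the partners excludes that.
  Cover : Fin m → Fin m → Set
  Cover c c′ = Σ (List (Fin m)) λ U → length U ≤ 6 ×
    (∀ a b → R a b c ≡ true → R a b c′ ≡ true → a ∈ U ⊎ b ∈ U)

  cover : ∀ c c′ → c ≢ c′ → Cover c c′
  cover c c′ c≢c′ with Fin.any? (λ a → Fin.any? (λ b → (R a b c Bool.≟ true) ×-dec (R a b c′ Bool.≟ true)))
  ... | no ¬x = [] , z≤n , λ a b p q → ⊥-elim (¬x (a , b , p , q))
  ... | yes (a₀ , b₀ , p₀ , q₀) with label steps p₀ | label steps q₀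
  ... | y₀ , ly₀ | z₀ , lz₀ = U , short , hit
    where
    -- Two points of the first pair and at most two partners from each of the labels `z₀` and `y₀`,
    -- hence at most 6.
    U : List (Fin m)
    U = a₀ ∷ b₀ ∷ partners z₀ c ++ partners y₀ c′
    short : length U ≤ 6
    short = s≤s (s≤s (≤-trans (≤-reflexive (length-++ (partners z₀ c)))
              (+-mono-≤ (length-partners z₀ c) (length-partners y₀ c′))))
    rot² : ∀ y {a b c} → tl y a b c ≡ true → tl y c a b ≡ true
    rot² y = Tl.rotate y ∘ Tl.rotate y
    hit : ∀ a b → R a b c ≡ true → R a b c′ ≡ true → a ∈ U ⊎ b ∈ U
    hit a b p q with ∈? a U | ∈? b U
    ... | yes k | _     = inj₁ k
    ... | no _  | yes k = inj₂ k
    ... | no a∉ | no b∉ with label steps p | label steps q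
    ... | y , ly | z , lz = ⊥-elim (no-core (record
      { a = a₀ ; b = b₀ ; c = c ; a′ = a ; b′ = b ; c′ = c′ ; y = y₀ ; z = z₀ ; y′ = y ; z′ = z
      ; points = (Tri-apart steps p₀ ∷ (Tri-apart steps (Tri-rotate steps (Tri-rotate steps p₀)) ∘ sym)
                    ∷ a₀≢a ∷ a₀≢b ∷ (Tri-apart steps (Tri-rotate steps (Tri-rotate steps q₀)) ∘ sym) ∷ [])
               ∷ (Tri-apart steps (Tri-rotate steps p₀) ∷ b₀≢a ∷ b₀≢b ∷ Tri-apart steps (Tri-rotate steps q₀) ∷ [])
               ∷ (Tri-apart steps (Tri-rotate steps (Tri-rotate steps p))
                    ∷ (Tri-apart steps (Tri-rotate steps p) ∘ sym) ∷ c≢c′ ∷ [])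
               ∷ (Tri-apart steps p ∷ (Tri-apart steps (Tri-rotate steps (Tri-rotate steps q)) ∘ sym) ∷ [])
               ∷ (Tri-apart steps (Tri-rotate steps q) ∷ []) ∷ [] ∷ []
      ; labels = (y₀≢z₀ ∷ y₀≢y ∷ y₀≢z ∷ []) ∷ (z₀≢y ∷ z₀≢z ∷ []) ∷ (y≢z ∷ []) ∷ [] ∷ []
      ; ya = Tl.inside y₀ ly₀ ; yb = Tl.inside y₀ (Tl.rotate y₀ ly₀) ; yc = Tl.inside y₀ (rot² y₀ ly₀)
      ; za = Tl.inside z₀ lz₀ ; zb = Tl.inside z₀ (Tl.rotate z₀ lz₀) ; zc′ = Tl.inside z₀ (rot² z₀ lz₀)
      ; y′c = Tl.inside y (rot² y ly) ; y′a′ = Tl.inside y ly ; y′b′ = Tl.inside y (Tl.rotate y ly)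
      ; z′a′ = Tl.inside z lz ; z′b′ = Tl.inside z (Tl.rotate z lz) ; z′c′ = Tl.inside z (rot² z lz)
      ; ext = Tri⇒Ext steps q₀ }))
      where
      a₀≢a : a₀ ≢ a
      a₀≢a e = a∉ (here (sym e))
      a₀≢b : a₀ ≢ b
      a₀≢b e = b∉ (here (sym e))
      b₀≢a : b₀ ≢ a
      b₀≢a e = a∉ (there (here (sym e)))
      b₀≢b : b₀ ≢ b
      b₀≢b e = b∉ (there (here (sym e)))
      third : ∀ y {a b c c′} → tl y a b c ≡ true → tl y a b c′ ≡ true → c′ ≡ c
      third y f g with Tl.unique y f (Tl.rotate y (Tl.swap y g))
      ... | inj₁ e = ⊥-elim (Tl.apart y (Tl.rotate y g) (sym e))
      ... | inj₂ e = e
      -- Up to `z₀≢z` the two triples compared are different but share a point, so they cannot both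
      -- be blocks of one label.
      y₀≢z₀ : y₀ ≢ z₀
      y₀≢z₀ refl = c≢c′ (sym (third y₀ ly₀ lz₀))
      y≢z : y ≢ z
      y≢z refl = c≢c′ (sym (third y ly lz))
      y₀≢y : y₀ ≢ y
      y₀≢y refl with Tl.unique y (rot² y ly₀) (rot² y ly)
      ... | inj₁ e = a₀≢a (sym e)
      ... | inj₂ e = b₀≢a (sym e)
      z₀≢z : z₀ ≢ z
      z₀≢z refl with Tl.unique z (rot² z lz₀) (rot² z lz)
      ... | inj₁ e = a₀≢a (sym e)
      ... | inj₂ e = b₀≢a (sym e)
      -- The two triples compared here and in `y₀≢z` are disjoint, so one label could carry both. In
      -- that case `a` would be a partner of `c` (respectively `c′`) in that label, and so belong to
      -- `U`.
      z₀≢y : z₀ ≢ y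
      z₀≢y refl = a∉ (there (there (∈-++⁺ˡ (∈-partners y c (rot² y ly)))))
      y₀≢z : y₀ ≢ z
      y₀≢z refl = a∉ (there (there (∈-++⁺ʳ (partners z₀ c) (∈-partners z c′ (rot² z lz)))))

  -- The diagonal receives the empty list; the case `c′ ≡ c` is paid for by the summand 1 in
  -- `deg-bound`.
  U : Fin m → Fin m → List (Fin m)
  U c c′ with c Fin.≟ c′
  ... | yes _ = []
  ... | no ne = proj₁ (cover c c′ ne)

  length-U : ∀ c c′ → length (U c c′) ≤ 6
  length-U c c′ with c Fin.≟ c′
  ... | yes _ = z≤n
  ... | no ne = proj₁ (proj₂ (cover c c′ ne))

  U-hit : ∀ {c c′} → c′ ≢ c → ∀ a b → R a b c ≡ true → R a b c′ ≡ true → a ∈ U c c′ ⊎ b ∈ U c c′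
  U-hit {c} {c′} ne with c Fin.≟ c′
  ... | yes e  = ⊥-elim (ne (sym e))
  ... | no ne′ = proj₂ (proj₂ (cover c c′ ne′))

  deg : Fin m → Fin m → ℕ
  deg a b = count (R a b)

  g : Fin m → Fin m → ℕ
  g a c = count (λ c′ → does (∈? a (U c c′)))

  -- Double counting: each ordered pair `c`, `c′` contributes at most the length of `U c c′`, which
  -- is at most 6.
  sum-g : sumFin (λ a → sumFin (λ c → g a c)) ≤ m * (m * 6)
  sum-g = begin
    sumFin (λ a → sumFin (λ c → g a c))
      ≡⟨ sum-swap g ⟩
    sumFin (λ c → sumFin (λ a → g a c))
      ≤⟨ sum-≤ (λ c → ≤-trans (≤-reflexive (trans (sum-cong (λ a → count≡sum (λ c′ → does (∈? a (U c c′)))))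
                                (sum-swap (λ a c′ → ind (does (∈? a (U c c′)))))))
                       (sum-≤ (λ c′ → ≤-trans (≤-reflexive (sym (count≡sum (λ a → does (∈? a (U c c′))))))
                                 (≤-trans (count-∈? (U c c′)) (length-U c c′))))) ⟩
    m * (m * 6) ∎
    where open ≤-Reasoning

  -- Any further point `c′` completing `a`, `b` to a triple has `a` or `b` in `U c c′`, and so is
  -- counted by `g a c` or `g b c`.
  deg-bound : ∀ {a b c} → R a b c ≡ true → deg a b ≤ 1 + (g a c + g b c)
  deg-bound {a} {b} {c} p = ≤-trans (count-∪ split) (+-mono-≤ (count-≟ c)
      (count-∪ {q = λ c′ → does (∈? a (U c c′))} {r = λ c′ → does (∈? b (U c c′))} (λ c′ → ∨-elim)))
    where
    split : ∀ c′ → R a b c′ ≡ true → does (c′ Fin.≟ c) ≡ true ⊎ does (∈? a (U c c′)) ∨ does (∈? b (U c c′)) ≡ true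
    split c′ q = by (c′ Fin.≟ c)
      where
      by : (d : Dec (c′ ≡ c)) → does d ≡ true ⊎ does (∈? a (U c c′)) ∨ does (∈? b (U c c′)) ≡ true
      by (yes _) = inj₁ refl
      by (no ne) = inj₂ ([ (λ k → ∨-introˡ (dec-true (∈? a (U c c′)) k))
                         , (λ k → ∨-introʳ {does (∈? a (U c c′))} (dec-true (∈? b (U c c′)) k)) ]′ (U-hit ne a b p q))

  -- Summing deg-bound over the three pairs of a triple shows that one of them is poor.
  poor : Fin m → Fin m → Bool
  poor a b = does (deg a b ≤? 1 + (g a b + g b a))

  poor-pair : ∀ {a b c} → R a b c ≡ true → poor a b ≡ true ⊎ (poor b c ≡ true ⊎ poor c a ≡ true)
  poor-pair {a} {b} {c} p with true-or-false (poor a b) | true-or-false (poor b c) | true-or-false (poor c a)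
  ... | inj₁ e  | _       | _       = inj₁ e
  ... | inj₂ _  | inj₁ e  | _       = inj₂ (inj₁ e)
  ... | inj₂ _  | inj₂ _  | inj₁ e  = inj₂ (inj₂ e)
  ... | inj₂ ab | inj₂ bc | inj₂ ca = ⊥-elim (<⇒≱ (+-mono-< (above a b ab) (+-mono-< (above b c bc) (above c a ca))) (begin
    deg a b + (deg b c + deg c a)
      ≤⟨ +-mono-≤ (deg-bound p) (+-mono-≤ (deg-bound (Tri-rotate steps p)) (deg-bound (Tri-rotate steps (Tri-rotate steps p)))) ⟩
    -- Both sides contain `g` once for each of the six ordered pairs from `a`, `b`, `c`; regrouping
    -- them by unordered pair makes the bound for a pair independent of the third point.
    1 + (g a c + g b c) + (1 + (g b a + g c a) + (1 + (g c b + g a b)))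
      ≡⟨ rearrange (g a b) (g b a) (g b c) (g c b) (g c a) (g a c) ⟩
    1 + (g a b + g b a) + (1 + (g b c + g c b) + (1 + (g c a + g a c))) ∎))
    where
    open ≤-Reasoning
    above : ∀ a b → poor a b ≡ false → 1 + (g a b + g b a) < deg a b
    above a b e = ≰⇒> λ le → true≢false (dec-true (deg a b ≤? 1 + (g a b + g b a)) le) e
    rearrange : ∀ ab ba bc cb ca ac → 1 + (ac + bc) + (1 + (ba + ca) + (1 + (cb + ab))) ≡
                1 + (ab + ba) + (1 + (bc + cb) + (1 + (ca + ac)))
    rearrange = solve-∀

  -- Each triple is charged to one of its poor pairs. By the definition of `poor` and `sum-g`, the
  -- triples whose first pair is poor number at most `(1 + 6 + 6) * (m * m)`; the three rotations
  -- give 39.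
  vol-R : vol R ≤ 39 * (m * m)
  vol-R = begin
    vol R ≤⟨ vol-split {g = λ _ _ _ → false} {h = h} (λ a b c p → inj₂
               ([ (λ q → inj₁ (∧-intro p q))
                , [ (λ q → inj₂ (inj₁ (∧-intro (Tri-rotate steps p) q)))
                  , (λ q → inj₂ (inj₂ (∧-intro (Tri-rotate steps (Tri-rotate steps p)) q))) ]′ ]′ (poor-pair p))) ⟩
    vol {m} (λ _ _ _ → false) + 3 * vol h ≡⟨ cong (_+ 3 * vol h) empty ⟩
    3 * vol h ≤⟨ *-monoʳ-≤ 3 few ⟩
    3 * (m * (m * 1) + (m * (m * 6) + m * (m * 6))) ≡⟨ total m ⟩
    39 * (m * m) ∎
    where
    open ≤-Reasoning
    h : Fin m → Fin m → Fin m → Bool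
    h a b c = R a b c ∧ poor a b
    total : ∀ m → 3 * (m * (m * 1) + (m * (m * 6) + m * (m * 6))) ≡ 39 * (m * m)
    total = solve-∀
    empty : vol {m} (λ _ _ _ → false) ≡ 0
    empty = trans (sum-cong {m} (λ a → trans (sum-cong {m} (λ b → count-none {m} (λ _ ()))) (trans (sum-const {m} 0) (*-zeroʳ m))))
              (trans (sum-const {m} 0) (*-zeroʳ m))
    row : ∀ a b → count (h a b) ≤ 1 + (g a b + g b a)
    row a b with true-or-false (poor a b)
    ... | inj₁ e = ≤-trans (count-mono {p = h a b} {q = R a b} (λ c → ∧-left)) (does-true (deg a b ≤? 1 + (g a b + g b a)) e)
    ... | inj₂ e = ≤-trans (≤-reflexive (count-none {p = h a b} (λ c q → true≢false (∧-right {R a b c} q) e))) z≤n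
    few : vol h ≤ m * (m * 1) + (m * (m * 6) + m * (m * 6))
    few = begin
      vol h ≤⟨ sum-mono (λ a → ≤-trans (sum-mono (row a)) (≤-reflexive (trans (sum-+ (λ b → 1) (λ b → g a b + g b a))
                 (cong₂ _+_ (sum-const {m} 1) (sum-+ (g a) (λ b → g b a)))))) ⟩
      sumFin {m} (λ a → m * 1 + (sumFin (g a) + sumFin (λ b → g b a)))
        ≡⟨ trans (sum-+ {m} (λ a → m * 1) _) (cong₂ _+_ (sum-const {m} (m * 1)) (sum-+ (λ a → sumFin (g a)) (λ a → sumFin (λ b → g b a)))) ⟩
      m * (m * 1) + (sumFin (λ a → sumFin (g a)) + sumFin (λ a → sumFin (λ b → g b a)))
        ≤⟨ +-monoʳ-≤ (m * (m * 1)) (+-mono-≤ sum-g (≤-trans (≤-reflexive (sum-swap (λ a b → g b a))) sum-g)) ⟩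
      m * (m * 1) + (m * (m * 6) + m * (m * 6)) ∎

  -- Passing to the next level deletes a triple only if one of its pairs is not rich. Such a pair
  -- lies in at most `2 * M` triples, and the three rotations give `6 * M` per ordered pair of
  -- points.
  vol-Tri : ∀ j → vol (Tri zero) ≤ vol (Tri j) + j * (6 * M * (m * m))
  vol-Tri zero    = ≤-reflexive (sym (+-identityʳ _))
  vol-Tri (suc j) = begin
    vol (Tri zero) ≤⟨ vol-Tri j ⟩
    vol (Tri j) + j * B ≤⟨ +-monoˡ-≤ (j * B) (≤-trans (vol-split {g = Tri (suc j)} {h = h} split) (+-monoʳ-≤ (vol (Tri (suc j))) lost)) ⟩
    vol (Tri (suc j)) + B + j * B ≡⟨ +-assoc (vol (Tri (suc j))) B _ ⟩
    vol (Tri (suc j)) + suc j * B ∎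
    where
    open ≤-Reasoning
    B : ℕ
    B = 6 * M * (m * m)
    h : Fin m → Fin m → Fin m → Bool
    h a b c = Tri j a b c ∧ not (rich (Tri j) a b)
    row : ∀ a b → count (h a b) ≤ 2 * M
    row a b with true-or-false (rich (Tri j) a b)
    ... | inj₂ e = ≤-trans (count-mono {p = h a b} {q = Tri j a b} (λ c → ∧-left))
                     (≮⇒≥ λ lt → true≢false (dec-true (2 * M <? count (Tri j a b)) lt) e)
    ... | inj₁ e = ≤-trans (≤-reflexive (count-none {p = h a b} (λ c q → true≢false e (not-true (∧-right {Tri j a b c} q))))) z≤n
    lost : 3 * vol h ≤ B
    lost = ≤-trans (*-monoʳ-≤ 3 (sum-≤ (λ a → sum-≤ (row a)))) (≤-reflexive (total m M))
      where total : ∀ m M → 3 * (m * (m * (2 * M))) ≡ 6 * M * (m * m)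
            total = solve-∀
    split : ∀ a b c → Tri j a b c ≡ true →
            Tri (suc j) a b c ≡ true ⊎ (h a b c ≡ true ⊎ (h b c a ≡ true ⊎ h c a b ≡ true))
    split a b c p with true-or-false (rich (Tri j) a b) | true-or-false (rich (Tri j) b c) | true-or-false (rich (Tri j) c a)
    ... | inj₂ e | _      | _      = inj₂ (inj₁ (∧-intro p (cong not e)))
    ... | inj₁ _ | inj₂ e | _      = inj₂ (inj₂ (inj₁ (∧-intro (Tri-rotate j p) (cong not e))))
    ... | inj₁ _ | inj₁ _ | inj₂ e = inj₂ (inj₂ (inj₂ (∧-intro (Tri-rotate j (Tri-rotate j p)) (cong not e))))
    ... | inj₁ x | inj₁ y | inj₁ z = inj₁ (∧-intro p (∧-intro x (∧-intro y z)))

  -- Each trace is paid for by its packing, and a thin triple is a block for at most `M` labels. The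
  -- number of distinct triples is then bounded by `vol-Tri` and `vol-R`.
  incidences : sumFin (λ y → count (I y)) ≤ n * (2 + M) + density M steps * (m * m)
  incidences = begin
    sumFin (λ y → count (I y)) ≤⟨ sum-mono (λ y → Tl.large y) ⟩
    sumFin (λ y → 2 + M + 3 * vol (tl y)) ≡⟨ trans (sum-+ {n} (λ y → 2 + M) _) (cong₂ _+_ (sum-const {n} (2 + M)) (sum-* 3 (λ y → vol (tl y)))) ⟩
    n * (2 + M) + 3 * sumFin (λ y → vol (tl y)) ≤⟨ +-monoʳ-≤ (n * (2 + M)) (*-monoʳ-≤ 3 multiplicity) ⟩
    n * (2 + M) + 3 * (M * vol (Tri zero))
      ≤⟨ +-monoʳ-≤ (n * (2 + M)) (*-monoʳ-≤ 3 (*-monoʳ-≤ M (≤-trans (vol-Tri steps) (+-monoˡ-≤ _ vol-R)))) ⟩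
    n * (2 + M) + 3 * (M * (39 * (m * m) + steps * (6 * M * (m * m)))) ≡⟨ cong (n * (2 + M) +_) (total m M steps) ⟩
    n * (2 + M) + density M steps * (m * m) ∎
    where
    open ≤-Reasoning
    total : ∀ m M s → 3 * (M * (39 * (m * m) + s * (6 * M * (m * m)))) ≡ 3 * (M * (39 + s * (6 * M))) * (m * m)
    total = solve-∀
    -- All labels having this block lie in `common a b c`, which is thin as soon as one such label
    -- exists.
    few : ∀ a b c → sumFin (λ y → ind (tl y a b c)) ≤ M * ind (Tri zero a b c)
    few a b c with true-or-false (Tri zero a b c)
    ... | inj₁ e with label zero {a} {b} {c} e
    ... | y , e′ = ≤-trans (≤-reflexive (sym (count≡sum (λ y → tl y a b c))))
          (≤-trans (count-mono (λ z q → ∧-intro (Tl.inside z q) (∧-intro (Tl.inside z (Tl.rotate z q)) (Tl.inside z (Tl.rotate z (Tl.rotate z q))))))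
            (≤-trans (Tl.thin y e′) (≤-reflexive (trans (sym (*-identityʳ M)) (cong (λ w → M * ind w) (sym e))))))
    few a b c | inj₂ e = ≤-trans (≤-reflexive (trans (sym (count≡sum (λ y → tl y a b c)))
      (count-none (λ y q → true≢false (dec-true (Fin.any? (λ y → tl y a b c Bool.≟ true)) (y , q)) e)))) z≤n
    pull : ∀ {k} (f : Fin n → Fin k → ℕ) (h : Fin k → ℕ) → (∀ i → sumFin (λ y → f y i) ≤ M * h i) →
           sumFin (λ y → sumFin (f y)) ≤ M * sumFin h
    pull f h le = ≤-trans (≤-reflexive (sum-swap f)) (≤-trans (sum-mono le) (≤-reflexive (sum-* M h)))
    multiplicity : sumFin (λ y → vol (tl y)) ≤ M * vol (Tri zero)
    multiplicity = pull (λ y a → sumFin (λ b → count (tl y a b))) (λ a → sumFin (λ b → count (Tri zero a b))) λ a →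
      pull (λ y b → count (tl y a b)) (λ b → count (Tri zero a b)) λ b →
      subst (_≤ M * count (Tri zero a b)) (sum-cong (λ y → sym (count≡sum (tl y a b))))
        (≤-trans (pull (λ y c → ind (tl y a b c)) (λ c → ind (Tri zero a b c)) (few a b))
          (≤-reflexive (cong (M *_) (sym (count≡sum (Tri zero a b))))))

-- Embedding the graphs

-- Each step of `Ext` appends a label and a point, so the graphs embedded are those with
-- `11 + double i` vertices. The recursion makes `Stage (suc s)` two vertices longer by computation.
double : ℕ → ℕ
double zero    = 0
double (suc i) = suc (suc (double i))

double-mono : ∀ {i j} → i ≤ j → double i ≤ double j
double-mono z≤n     = z≤n
double-mono (s≤s h) = s≤s (s≤s (double-mono h))

double-injective : ∀ {i j} → double i ≡ double j → i ≡ j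
double-injective {zero}  {zero}  e = refl
double-injective {suc i} {suc j} e = cong suc (double-injective (suc-injective (suc-injective e)))

turn-even : ∀ s → turn (double s) ≡ 2
turn-even zero    = refl
turn-even (suc s) = turn-even s

turn-odd : ∀ s → turn (suc (double s)) ≡ 0
turn-odd zero    = refl
turn-odd (suc s) = turn-odd s

snoc : {A : Set} → (ℕ → A) → ℕ → A → ℕ → A
snoc f L w v with v ≟ L
... | yes _ = w
... | no _  = f v

snoc-new : {A : Set} (f : ℕ → A) (L : ℕ) (w : A) → snoc f L w L ≡ w
snoc-new f L w with L ≟ L
... | yes _ = refl
... | no ne = ⊥-elim (ne refl)

snoc-old : {A : Set} (f : ℕ → A) {L : ℕ} (w : A) {v : ℕ} → v < L → snoc f L w v ≡ f v
snoc-old f {L} w {v} lt with v ≟ L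
... | yes refl = ⊥-elim (<-irrefl refl lt)
... | no _     = refl

distinct⇒injective : {A : Set} (f : ℕ → A) (L : ℕ) → AllPairs _≢_ (applyUpTo f L) →
                     ∀ {u v} → u < L → v < L → f u ≡ f v → u ≡ v
distinct⇒injective f (suc L) (d ∷ ds) {zero}  {zero}  _ _ e = refl
distinct⇒injective f (suc L) (d ∷ ds) {zero}  {suc v} _ (s≤s lv) e = ⊥-elim (applyUpTo⁻ (f ∘ suc) L d lv e)
distinct⇒injective f (suc L) (d ∷ ds) {suc u} {zero}  (s≤s lu) _ e = ⊥-elim (applyUpTo⁻ (f ∘ suc) L d lu (sym e))
distinct⇒injective f (suc L) (d ∷ ds) {suc u} {suc v} (s≤s lu) (s≤s lv) e =
  cong suc (distinct⇒injective (f ∘ suc) L ds lu lv e)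

parent<11+ : ∀ k → parent₁ (11 + k) < 11 + k × parent₂ (11 + k) < 11 + k
parent<11+ k = ≤-refl , m<n⇒m<1+n (turn<10+ k)

parent<core : ∀ v → suc v < 11 → parent₁ (suc v) < suc v × parent₂ (suc v) < suc v
parent<core v lt = let p , q = All.lookup {P = Ok} table (∈-upTo⁺ (≤-pred lt)) in p , q
  where
  Ok : ℕ → Set
  Ok v = parent₁ (suc v) < suc v × parent₂ (suc v) < suc v
  table : All Ok (upTo 10)
  table = toWitness {a? = All.all? (λ v → (parent₁ (suc v) <? suc v) ×-dec (parent₂ (suc v) <? suc v)) (upTo 10)} _

parent< : ∀ v → 0 < v → parent₁ v < v × parent₂ v < v
parent< (suc v) _ with suc v <? 11
... | yes lt = parent<core v lt
... | no ge  = subst (λ w → parent₁ w < w × parent₂ w < w) (m+[n∸m]≡n (≮⇒≥ ge)) (parent<11+ (suc v ∸ 11))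

module Embedding (G : Graph) (r : Fin (size G)) {m : ℕ} (pt : Fin m → Fin (size G))
                 (pt-inj : ∀ i j → pt i ≡ pt j → i ≡ j) (r~pt : ∀ x → adj G r (pt x) ≡ true)
                 (M : ℕ) (6≤M : 6 ≤ M) where

  V : Set
  V = Fin (size G)

  _~_ : V → V → Set
  u ~ v = adj G u v ≡ true

  ~-sym : ∀ {u v} → u ~ v → v ~ u
  ~-sym {u} {v} e = trans (Graph.sym G v u) e

  ~⇒≢ : ∀ {u v} → u ~ v → u ≢ v
  ~⇒≢ {u} e refl = true≢false e (irrefl G u)

  points : List V
  points = tabulate pt

  -- Vertices of the hypergraph on the neighbours of r are kept apart from its labels.
  I : V → Fin m → Bool
  I y x = adj G y (pt x) ∧ not (does (∈? y (r ∷ points)))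

  open Link I pt pt-inj M 6≤M

  I⇒~ : ∀ {y x} → I y x ≡ true → y ~ pt x
  I⇒~ = ∧-left

  I⇒∉ : ∀ {y x} → I y x ≡ true → y ∉ r ∷ points
  I⇒∉ {y} {x} e k = true≢false (dec-true (∈? y (r ∷ points)) k) (not-true (∧-right {adj G y (pt x)} e))

  r≢label : ∀ {y x} → I y x ≡ true → r ≢ y
  r≢label e q = I⇒∉ e (here (sym q))

  label≢pt : ∀ {y x} → I y x ≡ true → ∀ w → y ≢ pt w
  label≢pt e w refl = I⇒∉ e (there (∈-tabulate⁺ w))

  r≢pt : ∀ x → r ≢ pt x
  r≢pt x = ~⇒≢ (r~pt x)

  pt≢ : ∀ {x w} → x ≢ w → pt x ≢ pt w
  pt≢ ne e = ne (pt-inj _ _ e)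

  -- An embedding of the first `L` vertices. The map is total on ℕ but constrained only below `L`,
  -- so it can be extended by `snoc`; edges are recorded from each vertex to its parents.
  record Partial (L : ℕ) : Set where
    field
      f      : ℕ → V
      f-inj  : ∀ {u v} → u < L → v < L → f u ≡ f v → u ≡ v
      f-edge : ∀ v → 0 < v → v < L → f v ~ f (parent₁ v) × f v ~ f (parent₂ v)
  open Partial

  extend : ∀ {L} (P : Partial L) (w : V) → 0 < L → (∀ {u} → u < L → f P u ≢ w) →
           w ~ f P (parent₁ L) → w ~ f P (parent₂ L) → Partial (suc L)
  extend {L} P w 0<L fresh e₁ e₂ = record { f = f′ ; f-inj = inj ; f-edge = edge }
    where
    f′ : ℕ → V
    f′ = snoc (f P) L w
    case< : ∀ {v} → v < suc L → v < L ⊎ v ≡ L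
    case< lt = m≤n⇒m<n∨m≡n (≤-pred lt)
    inj′ : ∀ {u v} → u < L ⊎ u ≡ L → v < L ⊎ v ≡ L → f′ u ≡ f′ v → u ≡ v
    inj′ (inj₁ lu) (inj₁ lv) e = f-inj P lu lv (trans (sym (snoc-old (f P) w lu)) (trans e (snoc-old (f P) w lv)))
    inj′ (inj₁ lu) (inj₂ refl) e = ⊥-elim (fresh lu (trans (sym (snoc-old (f P) w lu)) (trans e (snoc-new (f P) L w))))
    inj′ (inj₂ refl) (inj₁ lv) e = ⊥-elim (fresh lv (trans (sym (snoc-old (f P) w lv)) (trans (sym e) (snoc-new (f P) L w))))
    inj′ (inj₂ refl) (inj₂ refl) e = refl
    inj : ∀ {u v} → u < suc L → v < suc L → f′ u ≡ f′ v → u ≡ v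
    inj lu lv = inj′ (case< lu) (case< lv)
    edge : ∀ v → 0 < v → v < suc L → f′ v ~ f′ (parent₁ v) × f′ v ~ f′ (parent₂ v)
    edge v 0<v lt with case< lt | parent< v 0<v
    ... | inj₁ lv   | p , q
        rewrite snoc-old (f P) w lv | snoc-old (f P) w (<-trans p lv) | snoc-old (f P) w (<-trans q lv) =
        f-edge P v 0<v lv
    ... | inj₂ refl | p , q
        rewrite snoc-new (f P) L w | snoc-old (f P) w p | snoc-old (f P) w q = e₁ , e₂

  -- The three vertices to which the next label and point attach: `hub` and `tip` for the label,
  -- `root` for the point.
  record Stage (s : ℕ) (b x : Fin m) : Set where
    field
      part : Partial (11 + double s)
      root : f part 0 ≡ r
      hub  : f part 2 ≡ pt b
      tip  : f part (10 + double s) ≡ pt x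

  advance : ∀ s {b x x′ y} (S : Stage s b x) → let L = 11 + double s ; g = f (Stage.part S) in
            pt x′ ∉ applyUpTo g L → y ∉ applyUpTo g L →
            I y b ≡ true → I y x ≡ true → I y x′ ≡ true → Stage (suc s) b x′
  advance s {b} {x} {x′} {y} S x′-new y-new yb yx yx′ = record
    { part = part₂
    ; root = trans (snoc-old g₁ {suc L} (pt x′) {0} (s≤s z≤n)) (trans (snoc-old g {L} y {0} (s≤s z≤n)) root)
    ; hub  = trans (snoc-old g₁ {suc L} (pt x′) {2} (s≤s (s≤s (s≤s z≤n)))) (trans (snoc-old g {L} y {2} (s≤s (s≤s (s≤s z≤n)))) hub)
    ; tip  = snoc-new g₁ (suc L) (pt x′) }
    where
    open Stage S
    L : ℕ
    L = 11 + double s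
    g : ℕ → V
    g = f part
    part₁ : Partial (suc L)
    -- The label takes the index `L`, whose parents are the tip and, by `turn-even`, vertex 2.
    part₁ = extend part y (s≤s z≤n) (λ lu e → y-new (subst (_∈ applyUpTo g L) e (∈-applyUpTo⁺ g lu)))
      (subst (y ~_) (sym tip) (I⇒~ yx))
      (subst (y ~_) (sym (trans (cong g (turn-even s)) hub)) (I⇒~ {y} {b} yb))
    g₁ : ℕ → V
    g₁ = f part₁
    part₂ : Partial (suc (suc L))
    -- The point takes the index `suc L`, whose parents are the new label and, by `turn-odd`, the
    -- root.
    part₂ = extend part₁ (pt x′) (s≤s z≤n) fresh
      (subst (pt x′ ~_) (sym (snoc-new g L y)) (~-sym (I⇒~ {y} {x′} yx′)))
      (subst (pt x′ ~_) (sym (trans (cong g₁ (turn-odd s)) (trans (snoc-old g {L} y {0} (s≤s z≤n)) root))) (~-sym (r~pt x′)))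
      where
      fresh : ∀ {u} → u < suc L → g₁ u ≢ pt x′
      fresh {u} lu e with m≤n⇒m<n∨m≡n (≤-pred lu)
      ... | inj₁ lt   = x′-new (subst (_∈ applyUpTo g L) (trans (sym (snoc-old g y lt)) e) (∈-applyUpTo⁺ g lt))
      ... | inj₂ refl = label≢pt yx′ x′ (trans (sym (snoc-new g L y)) e)

  -- Here `s` steps are done and `j` remain. Their sum is constant, so one inequality keeps every
  -- list of used vertices within `M`.
  chain : ∀ j s {b x} → 11 + double (j + s) ≤ M → Stage s b x → Ext j b x → Partial (11 + double (j + s))
  chain zero    s le S e = Stage.part S
  chain (suc j) s le S e =
    let g = f (Stage.part S)
        x′ , y , x′-new , y-new , yb , yx , yx′ , e′ = e (applyUpTo g (11 + double s))
          (≤-trans (≤-reflexive (length-applyUpTo g (11 + double s)))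
            (≤-trans (+-monoʳ-≤ 11 (double-mono (m≤n+m s (suc j)))) le))
    in subst (λ t → Partial (11 + double t)) (+-suc j s)
         (chain j (suc s) (subst (λ t → 11 + double t ≤ M) (sym (+-suc j s)) le)
           (advance s S x′-new y-new yb yx yx′) e′)

  core-stage : ∀ {i} (K : Core i) → Stage 0 (Core.b K) (Core.c′ K)
  core-stage K = record
    { part = record { f = h ; f-inj = distinct⇒injective h 11 (distinct (Core.points K) labels) ; f-edge = edge }
    ; root = refl ; hub = refl ; tip = refl }
    where
    open Core K hiding (points)
    h : ℕ → V
    h 0 = r
    h 1 = pt a
    h 2 = pt b
    h 3 = y
    h 4 = z
    h 5 = pt c
    h 6 = pt a′
    h 7 = y′
    h 8 = pt b′
    h 9 = z′
    h _ = pt c′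
    -- Points differ by injectivity of `pt`, the root differs from its neighbours, and the second
    -- conjunct of `I` separates labels from the root and from all points.
    distinct : AllPairs _≢_ (a ∷ b ∷ c ∷ a′ ∷ b′ ∷ c′ ∷ []) → AllPairs _≢_ (y ∷ z ∷ y′ ∷ z′ ∷ []) →
               AllPairs _≢_ (applyUpTo h 11)
    distinct ((d-ab ∷ d-ac ∷ d-aa′ ∷ d-ab′ ∷ d-ac′ ∷ []) ∷ (d-bc ∷ d-ba′ ∷ d-bb′ ∷ d-bc′ ∷ []) ∷ (d-ca′ ∷ d-cb′ ∷ d-cc′ ∷ []) ∷ (d-a′b′ ∷ d-a′c′ ∷ []) ∷ (d-b′c′ ∷ []) ∷ ([]) ∷ [])
             ((l-yz ∷ l-yy′ ∷ l-yz′ ∷ []) ∷ (l-zy′ ∷ l-zz′ ∷ []) ∷ (l-y′z′ ∷ []) ∷ ([]) ∷ []) =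
      ((r≢pt a) ∷ (r≢pt b) ∷ (r≢label ya) ∷ (r≢label za) ∷ (r≢pt c) ∷ (r≢pt a′) ∷ (r≢label y′c) ∷ (r≢pt b′) ∷ (r≢label z′a′) ∷ (r≢pt c′) ∷ [])
      ∷ ((pt≢ d-ab) ∷ (label≢pt ya a ∘ sym) ∷ (label≢pt za a ∘ sym) ∷ (pt≢ d-ac) ∷ (pt≢ d-aa′) ∷ (label≢pt y′c a ∘ sym) ∷ (pt≢ d-ab′) ∷ (label≢pt z′a′ a ∘ sym) ∷ (pt≢ d-ac′) ∷ [])
      ∷ ((label≢pt ya b ∘ sym) ∷ (label≢pt za b ∘ sym) ∷ (pt≢ d-bc) ∷ (pt≢ d-ba′) ∷ (label≢pt y′c b ∘ sym) ∷ (pt≢ d-bb′) ∷ (label≢pt z′a′ b ∘ sym) ∷ (pt≢ d-bc′) ∷ [])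
      ∷ ((l-yz) ∷ (label≢pt ya c) ∷ (label≢pt ya a′) ∷ (l-yy′) ∷ (label≢pt ya b′) ∷ (l-yz′) ∷ (label≢pt ya c′) ∷ [])
      ∷ ((label≢pt za c) ∷ (label≢pt za a′) ∷ (l-zy′) ∷ (label≢pt za b′) ∷ (l-zz′) ∷ (label≢pt za c′) ∷ [])
      ∷ ((pt≢ d-ca′) ∷ (label≢pt y′c c ∘ sym) ∷ (pt≢ d-cb′) ∷ (label≢pt z′a′ c ∘ sym) ∷ (pt≢ d-cc′) ∷ [])
      ∷ ((label≢pt y′c a′ ∘ sym) ∷ (pt≢ d-a′b′) ∷ (label≢pt z′a′ a′ ∘ sym) ∷ (pt≢ d-a′c′) ∷ [])
      ∷ ((label≢pt y′c b′) ∷ (l-y′z′) ∷ (label≢pt y′c c′) ∷ [])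
      ∷ ((label≢pt z′a′ b′ ∘ sym) ∷ (pt≢ d-b′c′) ∷ [])
      ∷ ((label≢pt z′a′ c′) ∷ []) ∷ [] ∷ []
    up : ∀ {w x} → I w x ≡ true → pt x ~ w
    up e = ~-sym (I⇒~ e)
    spoke : ∀ x → pt x ~ r
    spoke x = ~-sym (r~pt x)
    edge : ∀ v → 0 < v → v < 11 → h v ~ h (parent₁ v) × h v ~ h (parent₂ v)
    edge 1  _ _ = spoke a , spoke a
    edge 2  _ _ = spoke b , spoke b
    edge 3  _ _ = I⇒~ ya , I⇒~ yb
    edge 4  _ _ = I⇒~ za , I⇒~ zb
    edge 5  _ _ = spoke c , up yc
    edge 6  _ _ = spoke a′ , spoke a′
    edge 7  _ _ = I⇒~ y′c , I⇒~ y′a′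
    edge 8  _ _ = spoke b′ , up y′b′
    edge 9  _ _ = I⇒~ z′a′ , I⇒~ z′b′
    edge 10 _ _ = up zc′ , up z′c′
    edge (suc (suc (suc (suc (suc (suc (suc (suc (suc (suc (suc v))))))))))) _ lt = ⊥-elim (<⇒≱ lt (m≤m+n 11 v))

  partial⇒contains : ∀ {k} → Partial (11 + k) → Contains G (H k)
  partial⇒contains P = f P ∘ toℕ ,
    (λ u v e → Fin.toℕ-injective (f-inj P (Fin.toℕ<n u) (Fin.toℕ<n v) e)) ,
    λ u v e → [ (λ q → ~-sym (down u v q)) , down v u ]′ (∨-elim {below (toℕ u) (toℕ v)} e)
    where
    down : ∀ u v → below (toℕ u) (toℕ v) ≡ true → f P (toℕ v) ~ f P (toℕ u)
    down u v q with f-edge P (toℕ v) (≤-<-trans z≤n (below⇒< (toℕ u) (toℕ v) q)) (Fin.toℕ<n v) | below⇒parent (toℕ u) (toℕ v) q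
    ... | e₁ , e₂ | inj₁ h = subst (λ w → f P (toℕ v) ~ f P w) (sym h) e₁
    ... | e₁ , e₂ | inj₂ h = subst (λ w → f P (toℕ v) ~ f P w) (sym h) e₂

  core⇒contains : ∀ i → 11 + double (i + 0) ≤ M → Core i → Contains G (H (double (i + 0)))
  core⇒contains i le K = partial⇒contains (chain i 0 le (core-stage K) (Core.ext K))

-- The extremal bound

-- The chosen neighbours of `r` have total degree at least `d * (m * m)`. At most `1 + m` of each
-- degree goes to `r` or to other chosen points, and the rest are incidences, bounded without a core
-- by `(2 + M + Q) * (m * m)`, where `Q` is the density. Taking `M` to be the order of
-- `H (double i)` leaves room for every list of used vertices.
root-bound : ∀ (G : Graph) i → ¬ Contains G (H (double i)) → ∀ m d →
  let M = 11 + double i in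
  0 < m → size G ≤ m * m → 5 + M + density M i ≤ d → (r : Fin (size G)) →
  m ≤ count (λ j → adj G r j ∧ does (d * m ≤? degree G j)) → ⊥
root-bound G i free m d 0<m n≤m² 5+Q≤d r many =
  <⇒≱ too-few (begin
    m * (d * m)
      ≤⟨ ≤-trans (≤-reflexive (sym (sum-const {m} (d * m)))) (sum-mono row) ⟩
    sumFin (λ x → sumFin (λ y → ind (I y x)) + (1 + m))
      ≡⟨ trans (sum-+ (λ x → sumFin (λ y → ind (I y x))) (λ _ → 1 + m)) (cong₂ _+_ (sum-swap (λ x y → ind (I y x))) (sum-const {m} (1 + m))) ⟩
    sumFin (λ y → sumFin (λ x → ind (I y x))) + m * (1 + m)
      ≡⟨ cong (_+ m * (1 + m)) (sum-cong (λ y → sym (count≡sum (I y)))) ⟩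
    sumFin (λ y → count (I y)) + m * (1 + m)
      ≤⟨ +-mono-≤ (CoreFree.incidences I pt pt-inj M 6≤M i no-core)
                  (*-monoʳ-≤ m (+-monoˡ-≤ m 0<m)) ⟩
    size G * (2 + M) + Q * (m * m) + m * (m + m)
      ≤⟨ +-monoˡ-≤ (m * (m + m)) (+-monoˡ-≤ (Q * (m * m)) (*-monoˡ-≤ (2 + M) n≤m²)) ⟩
    m * m * (2 + M) + Q * (m * m) + m * (m + m)
      ≡⟨ total m M Q ⟩
    (4 + M + Q) * (m * m) ∎)
  where
  open ≤-Reasoning
  M : ℕ
  M = 11 + double i
  Q : ℕ
  Q = density M i
  6≤M : 6 ≤ M
  6≤M = ≤-trans (toWitness {a? = 6 ≤? 11} _) (m≤m+n 11 (double i))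
  chosen : Σ (Fin m → Fin (size G)) λ f → (∀ x w → f x ≡ f w → x ≡ w) ×
           (∀ x → adj G r (f x) ∧ does (d * m ≤? degree G (f x)) ≡ true)
  chosen = count-inject many
  pt : Fin m → Fin (size G)
  pt = proj₁ chosen
  pt-inj : ∀ x w → pt x ≡ pt w → x ≡ w
  pt-inj = proj₁ (proj₂ chosen)
  open Embedding G r pt pt-inj (λ x → ∧-left (proj₂ (proj₂ chosen) x)) M 6≤M
  no-core : ¬ Link.Core I pt pt-inj M 6≤M i
  no-core K = free (subst (λ t → Contains G (H (double t))) (+-identityʳ i)
                (core⇒contains i (≤-reflexive (cong (λ t → 11 + double t) (+-identityʳ i))) K))
  total : ∀ m M Q → m * m * (2 + M) + Q * (m * m) + m * (m + m) ≡ (4 + M + Q) * (m * m)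
  total = solve-∀
  row : ∀ x → d * m ≤ sumFin (λ y → ind (I y x)) + (1 + m)
  row x = ≤-trans (does-true (d * m ≤? degree G (pt x)) (∧-right {adj G r (pt x)} (proj₂ (proj₂ chosen) x)))
    (≤-trans (count-∪ {q = λ y → I y x} split)
      (+-mono-≤ (≤-reflexive (count≡sum (λ y → I y x)))
        (≤-trans (count-∈? (r ∷ points)) (s≤s (≤-reflexive (length-tabulate pt))))))
    where
    split : ∀ y → adj G (pt x) y ≡ true → I y x ≡ true ⊎ does (∈? y (r ∷ points)) ≡ true
    split y e with true-or-false (does (∈? y (r ∷ points)))
    ... | inj₁ k = inj₂ k
    ... | inj₂ k = inj₁ (∧-intro (~-sym e) (cong not k))
  too-few : (4 + M + Q) * (m * m) < m * (d * m)
  -- The constant 5 in the hypothesis on `d` exceeds the 4 obtained by one, which gives strictness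
  -- since `m` is positive.
  too-few = begin-strict
    (4 + M + Q) * (m * m) <⟨ m<n+m _ (*-mono-≤ 0<m 0<m) ⟩
    m * m + (4 + M + Q) * (m * m) ≤⟨ *-monoˡ-≤ (m * m) 5+Q≤d ⟩
    d * (m * m) ≡⟨ swap d m ⟩
    m * (d * m) ∎
    where swap : ∀ d m → d * (m * m) ≡ m * (d * m)
          swap = solve-∀

-- An edge with `i < j` is charged to `i` if `j` has degree at least `δ`, and to `j` otherwise. A
-- vertex receives at most `m` charges of the first kind and at most `δ` of the second.
edges-bound : ∀ G m δ →
  (∀ r → count (λ j → adj G r j ∧ does (δ ≤? degree G j)) ≤ m) → edges G ≤ size G * m + size G * δ
edges-bound G m δ few = begin
  edges G
    ≤⟨ sum-mono (λ i → count-∪ {q = λ j → adj G i j ∧ high j} {r = λ j → adj G i j ∧ not (high j)} (split i)) ⟩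
  sumFin (λ i → count (λ j → adj G i j ∧ high j) + count (λ j → adj G i j ∧ not (high j)))
    ≡⟨ sum-+ (λ i → count (λ j → adj G i j ∧ high j)) _ ⟩
  sumFin (λ i → count (λ j → adj G i j ∧ high j)) + sumFin (λ i → count (λ j → adj G i j ∧ not (high j)))
    ≤⟨ +-mono-≤ (sum-≤ few) (≤-trans (≤-reflexive (trans (sum-cong (λ i → count≡sum (λ j → adj G i j ∧ not (high j))))
         (sum-swap (λ i j → ind (adj G i j ∧ not (high j)))))) (sum-≤ column)) ⟩
  size G * m + size G * δ ∎
  where
  open ≤-Reasoning
  high : Fin (size G) → Bool
  high j = does (δ ≤? degree G j)
  split : ∀ i j → adj G i j ∧ (toℕ i <ᵇ toℕ j) ≡ true → adj G i j ∧ high j ≡ true ⊎ adj G i j ∧ not (high j) ≡ true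
  split i j e with true-or-false (high j)
  ... | inj₁ h = inj₁ (∧-intro (∧-left e) h)
  ... | inj₂ h = inj₂ (∧-intro (∧-left e) (cong not h))
  column : ∀ j → sumFin (λ i → ind (adj G i j ∧ not (high j))) ≤ δ
  column j = ≤-trans (≤-reflexive (sym (count≡sum (λ i → adj G i j ∧ not (high j))))) (low (true-or-false (high j)))
    where
    low : high j ≡ true ⊎ high j ≡ false → count (λ i → adj G i j ∧ not (high j)) ≤ δ
    low (inj₁ h) = ≤-trans (≤-reflexive (count-none (λ i e → true≢false h (not-true (∧-right {adj G i j} e))))) z≤n
    low (inj₂ h) = ≤-trans (count-mono {q = adj G j} (λ i e → trans (Graph.sym G j i) (∧-left e)))
                     (<⇒≤ (≰⇒> λ le → true≢false (dec-true (δ ≤? degree G j) le) h))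

square-root : ∀ n → ∃ λ m → n ≤ m * m × m * m ≤ 4 * n
square-root zero    = 0 , z≤n , z≤n
square-root (suc n) with square-root n
... | m , lo , hi with suc n ≤? m * m
... | yes le = m , le , ≤-trans hi (*-monoʳ-≤ 4 (n≤1+n n))
-- Here `m * m ≤ n`, so the next square is at most `3 * (m * m) + 4`, hence at most `4 * suc n`.
... | no ¬le = suc m , s≤s (≤-trans lo (≤-trans (*-monoʳ-≤ m (n≤1+n m)) (m≤n+m _ m))) , (begin
  suc m * suc m           ≡⟨ expand m ⟩
  m * m + 2 * m + 1       ≤⟨ +-mono-≤ (+-monoʳ-≤ (m * m) (*-monoʳ-≤ 2 (m≤m*m m))) (toWitness {a? = 1 ≤? 4} _) ⟩
  m * m + 2 * (m * m) + 4 ≡⟨ collect (m * m) ⟩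
  3 * (m * m) + 4         ≤⟨ +-monoˡ-≤ 4 (*-mono-≤ (toWitness {a? = 3 ≤? 4} _) (≤-pred (≰⇒> ¬le))) ⟩
  4 * n + 4               ≡⟨ trans (+-comm (4 * n) 4) (sym (*-suc 4 n)) ⟩
  4 * suc n               ∎)
  where
  open ≤-Reasoning
  expand : ∀ m → suc m * suc m ≡ m * m + 2 * m + 1
  expand = solve-∀
  collect : ∀ s → s + 2 * s + 4 ≡ 3 * s + 4
  collect = solve-∀
  m≤m*m : ∀ m → m ≤ m * m
  m≤m*m zero    = z≤n
  m≤m*m (suc m) = m≤m+n (suc m) _

H-ex : ∀ i → ExO3/2 (H (double i))
-- The number of edges is at most `suc d * (size G * m)` with `m * m ≤ 4 * size G`, whence the
-- factor 2. Requiring at least one vertex makes `m` positive.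
H-ex i = 2 * suc d , 1 , bound
  where
  M d : ℕ
  M = 11 + double i
  d = 5 + M + density M i
  bound : ∀ G → size G ≥ 1 → ¬ Contains G (H (double i)) →
          edges G * edges G ≤ (2 * suc d * (2 * suc d)) * (size G * size G * size G)
  bound G 1≤n free with square-root (size G)
  ... | m , lo , hi = begin
    edges G * edges G
      ≤⟨ *-mono-≤ few few ⟩
    (size G * m + size G * (d * m)) * (size G * m + size G * (d * m))
      ≡⟨ factor (size G) m d ⟩
    (m * m) * (suc d * suc d * (size G * size G))
      ≤⟨ *-monoˡ-≤ (suc d * suc d * (size G * size G)) hi ⟩
    4 * size G * (suc d * suc d * (size G * size G))
      ≡⟨ collect (size G) d ⟩
    (2 * suc d * (2 * suc d)) * (size G * size G * size G) ∎
    where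
    open ≤-Reasoning
    0<m : 0 < m
    0<m = n≢0⇒n>0 λ { refl → <⇒≱ 1≤n lo }
    few : edges G ≤ size G * m + size G * (d * m)
    few = edges-bound G m (d * m) λ r → ≮⇒≥ λ lt →
      root-bound G i free m d 0<m lo ≤-refl r (<⇒≤ lt)
    factor : ∀ n m d → (n * m + n * (d * m)) * (n * m + n * (d * m)) ≡ (m * m) * (suc d * suc d * (n * n))
    factor = solve-∀
    collect : ∀ n d → 4 * n * (suc d * suc d * (n * n)) ≡ (2 * suc d * (2 * suc d)) * (n * n * n)
    collect = solve-∀

theorem3 : Σ (ℕ → Graph) λ H →
    (∀ i j → i ≢ j → ¬ Isomorphic (H i) (H j)) ×
    (∀ i → CriticalDegenerate 2 (H i) × ExO3/2 (H i))
theorem3 = H ∘ double ,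
  (λ i j i≢j iso → i≢j (double-injective (+-cancelˡ-≡ 11 _ _ (isomorphic⇒size (H (double i)) (H (double j)) iso)))) ,
  λ i → H-critical (double i) , H-ex i
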